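{- The pair $(\to_{\mathtt f},\multimap_{\mathtt{uf}})$, formed by the Fireball Calculus reduction and the Useful Fireball Calculus reduction, is a locally bounded high-level implementation system, and so $\multimap_{\mathtt{uf}}$ has a quadratic overhead with respect to $\to_{\mathtt f}$, i.e. $|d|=O(|d{\downarrow}|^2)$ for every derivation $d:t\multimap_{\mathtt{uf}}^*u$ from a $\lambda$-term $t$ without explicit substitutions, where $d{\downarrow}:t\to_{\mathtt f}^*u{\downarrow}$ is its projection.
   Context: **Fireball Calculus (FBC).** Terms ($\lambda$-terms): $t,u ::= x\mid a\mid\lambda x.t\mid tu$, where $x$ ranges over variables and $a$ over a separate set of symbols (constants, never bound nor substituted). Terms are taken up to $\alpha$-equivalence; $t\{x\leftarrow u\}$ is capture-avoiding substitution. Values $v::=\lambda x.t$; fireballs $f::=v\mid A$; inerts $A::=a\mid Af$. Evaluation contexts $F::=\langle\cdot\rangle\mid tF\mid Ff$. The rule is $F\langle(\lambda x.t)f\rangle\to_{\mathtt f}F\langle t\{x\leftarrow f\}\rangle$. **Explicit substitutions (ES).** Terms with ES add the construct $t[x\leftarrow u]$, binding $x$ in $t$. Values are still the abstractions. Unfolding: $x{\downarrow}=x$, $a{\downarrow}=a$, $(tu){\downarrow}=t{\downarrow}\,u{\downarrow}$, $(\lambda x.t){\downarrow}=\lambda x.t{\downarrow}$, $t[x\leftarrow u]{\downarrow}=t{\downarrow}\{x\leftarrow u{\downarrow}\}$. Plugging in a context may capture variables. Substitution contexts $L::=\langle\cdot\rangle\mid L[x\leftarrow t]$. Shallow contexts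 $S::=\langle\cdot\rangle\mid St\mid tS\mid S[x\leftarrow t]$. Unfolding of $t$ relative to $S$: $t{\downarrow}_{\langle\cdot\rangle}=t{\downarrow}$, $t{\downarrow}_{uS}=t{\downarrow}_{Su}=t{\downarrow}_S$, $t{\downarrow}_{S[x\leftarrow u]}=t{\downarrow}_S\{x\leftarrow u{\downarrow}\}$. **Useful contexts.** Evaluable shallow contexts: $\langle\cdot\rangle$ is evaluable; $St$ is evaluable if $S$ is and $t{\downarrow}$ is a fireball; $tS$ is evaluable if $S$ is; $S[x\leftarrow t]$ is evaluable if $t{\downarrow}$ is a fireball and $S\{x\leftarrow t{\downarrow}\}$ is evaluable. $S$ is applicative if $S=S'\langle L\,u\rangle$ for some $S',L,u$ (the hole of $S$ being the hole of $L$); $S$ is useful if it is evaluable and applicative. **Useful FBC.** $\multimap_{\mathtt{uf}}=\multimap_{\mathtt{um}}\cup\multimap_{\mathtt{ue}}$ (up to $\alpha$; the displayed $x$ is bound by the displayed ES on $x$, and moving $L$ outwards captures no variable): - (multiplicative) $S\langle L\langle\lambda x.t\rangle u\rangle\multimap_{\mathtt{um}}S\langle L\langle t[x\leftarrow u]\rangle\rangle$ if $S\langle L\,u\rangle$ is useful; - (exponential) $S\langle S'\langle x\rangle[x\leftarrow L\langle u\rangle]\rangle\multimap_{\mathtt{ue}}S\langle L\langle S'\langle u\rangle[x\leftarrow u]\rangle\rangle$ if $S\langle S'[x\leftarrow L\langle u\rangle]\rangle$ is useful, $u$ is not of the form $u'[y\leftarrow w]$, and $u{\downarrow}_{S\langle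 L\rangle}$ is a value. **High-level implementation systems.** For a derivation $d$, $|d|$ is its length and $|d|_{\mathtt m}$, $|d|_{\mathtt e}$ its numbers of multiplicative and exponential steps. Given a deterministic strategy $\to_{\mathtt f}$ on FBC terms and a deterministic strategy $\multimap$ on terms with ES (made of multiplicative and exponential steps), $(\to_{\mathtt f},\multimap)$ is a high-level implementation system if whenever $t$ is a $\lambda$-term (no ES) and $d:t\multimap^*u$: (Normal form) if $u$ is $\multimap$-normal then $u{\downarrow}$ is $\to_{\mathtt f}$-normal; (Projection) there is a derivation $d{\downarrow}:t{\downarrow}\to_{\mathtt f}^*u{\downarrow}$ with $|d{\downarrow}|=|d|_{\mathtt m}$. It is locally bounded if, moreover, the length of any sequence of exponential steps from $u$ is linear in $|d|_{\mathtt m}$, i.e. at most $c\cdot|d|_{\mathtt m}$ for a constant $c$ independent of $t$ and $d$. -}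

module Defs where

open import Data.Fin.Base using (Fin; zero; suc)
open import Data.Nat.Base using (ℕ; zero; suc; _*_; _^_; _≤_)
open import Data.Product.Base using (Σ-syntax; ∃-syntax; _×_; proj₁)
open import Data.Sum.Base using (inj₁; inj₂)
open import Function.Base using (id; _∘_)
open import Level using (0ℓ)
open import Relation.Binary.Construct.Closure.ReflexiveTransitive using (Star; ε; _◅_)
open import Relation.Binary.Construct.Union using (_∪_)
open import Relation.Binary.Core using (Rel)
open import Relation.Binary.PropositionalEquality using (_≡_; refl; cong; cong₂)
open import Relation.Binary.Rewriting using (Deterministic; IsNormalForm)
open import Relation.Nullary.Negation.Core using (¬_)

-- Terms up to α are well-scoped de Bruijn terms: Term A k n has its free
-- variables in Fin n and its symbols in A.  Plain terms are the λ-terms of the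
-- Fireball Calculus; only terms of kind withES have explicit substitutions.

data Kind : Set where
  plain withES : Kind

data Term (A : Set) : Kind → ℕ → Set where
  var  : ∀ {k n} → Fin n → Term A k n
  symb : ∀ {k n} → A → Term A k n
  lam  : ∀ {k n} → Term A k (suc n) → Term A k n
  app  : ∀ {k n} → Term A k n → Term A k n → Term A k n
  -- es t u is t[x←u], binding x (index zero) in t
  es   : ∀ {n} → Term A withES (suc n) → Term A withES n → Term A withES n

private
  variable
    A     : Set
    k     : Kind
    n m p : ℕ

⌜_⌝ : Term A plain n → Term A withES n
⌜ var x ⌝   = var x
⌜ symb a ⌝  = symb a
⌜ lam t ⌝   = lam ⌜ t ⌝
⌜ app t u ⌝ = app ⌜ t ⌝ ⌜ u ⌝

Ren : ℕ → ℕ → Set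
Ren n m = Fin n → Fin m

liftᴿ : Ren n m → Ren (suc n) (suc m)
liftᴿ ρ zero    = zero
liftᴿ ρ (suc x) = suc (ρ x)

rename : Ren n m → Term A k n → Term A k m
rename ρ (var x)   = var (ρ x)
rename ρ (symb a)  = symb a
rename ρ (lam t)   = lam (rename (liftᴿ ρ) t)
rename ρ (app t u) = app (rename ρ t) (rename ρ u)
rename ρ (es t u)  = es (rename (liftᴿ ρ) t) (rename ρ u)

Sub : Set → Kind → ℕ → ℕ → Set
Sub A k n m = Fin n → Term A k m

liftˢ : Sub A k n m → Sub A k (suc n) (suc m)
liftˢ σ zero    = var zero
liftˢ σ (suc x) = rename suc (σ x)

sub : Sub A k n m → Term A k n → Term A k m
sub σ (var x)   = σ x
sub σ (symb a)  = symb a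
sub σ (lam t)   = lam (sub (liftˢ σ) t)
sub σ (app t u) = app (sub σ t) (sub σ u)
sub σ (es t u)  = es (sub (liftˢ σ) t) (sub σ u)

-- The substitution {x←u} for the variable x of index zero.
⟨x←_⟩ : Term A k n → Sub A k (suc n) n
⟨x← u ⟩ zero    = u
⟨x← u ⟩ (suc y) = var y

data Value {A : Set} {k : Kind} {n : ℕ} : Term A k n → Set where
  lam : ∀ {t} → Value (lam t)

mutual
  data Fireball {A : Set} {n : ℕ} : Term A plain n → Set where
    value : ∀ {v} → Value v → Fireball v
    inert : ∀ {t} → Inert t → Fireball t

  data Inert {A : Set} {n : ℕ} : Term A plain n → Set where
    symb : ∀ {a} → Inert (symb a)
    app  : ∀ {t f} → Inert t → Fireball f → Inert (app t f)

data EvalCtx (A : Set) (n : ℕ) : Set where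
  □    : EvalCtx A n
  appʳ : Term A plain n → EvalCtx A n → EvalCtx A n
  appˡ : EvalCtx A n → (f : Term A plain n) → Fireball f → EvalCtx A n

plugᶠ : EvalCtx A n → Term A plain n → Term A plain n
plugᶠ □            t = t
plugᶠ (appʳ u F)   t = app u (plugᶠ F t)
plugᶠ (appˡ F f _) t = app (plugᶠ F t) f

infix 4 _→f_

data _→f_ {A : Set} {n : ℕ} : Rel (Term A plain n) 0ℓ where
  step : ∀ (F : EvalCtx A n) t f → Fireball f →
         plugᶠ F (app (lam t) f) →f plugᶠ F (sub ⟨x← f ⟩ t)

infix 25 _↓

_↓ : Term A withES n → Term A plain n
var x ↓   = var x
symb a ↓  = symb a
lam t ↓   = lam (t ↓)
app t u ↓ = app (t ↓) (u ↓)
es t u ↓  = sub ⟨x← u ↓ ⟩ (t ↓)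

⌜⌝-↓ : (t : Term A plain n) → ⌜ t ⌝ ↓ ≡ t
⌜⌝-↓ (var x)   = refl
⌜⌝-↓ (symb a)  = refl
⌜⌝-↓ (lam t)   = cong lam (⌜⌝-↓ t)
⌜⌝-↓ (app t u) = cong₂ app (⌜⌝-↓ t) (⌜⌝-↓ u)

-- A Shallow A n m is a context whose free variables are in Fin n and whose
-- hole is in scope of Fin m, i.e. of the n variables and of the m - n ones
-- bound on the path to the hole.  Plugging thus captures variables.

data Shallow (A : Set) : ℕ → ℕ → Set where
  □    : Shallow A n n
  appˡ : Shallow A n m → Term A withES n → Shallow A n m
  appʳ : Term A withES n → Shallow A n m → Shallow A n m
  es   : Shallow A (suc n) m → Term A withES n → Shallow A n m

data SubCtx (A : Set) : ℕ → ℕ → Set where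
  □  : SubCtx A n n
  es : SubCtx A (suc n) m → Term A withES n → SubCtx A n m

⌊_⌋ : SubCtx A n m → Shallow A n m
⌊ □ ⌋      = □
⌊ es L t ⌋ = es ⌊ L ⌋ t

infix 20 _⟨_⟩ _⟪_⟫

_⟨_⟩ : Shallow A n m → Term A withES m → Term A withES n
□ ⟨ t ⟩        = t
appˡ S u ⟨ t ⟩ = app (S ⟨ t ⟩) u
appʳ u S ⟨ t ⟩ = app u (S ⟨ t ⟩)
es S u ⟨ t ⟩   = es (S ⟨ t ⟩) u

_⟪_⟫ : Shallow A n m → Shallow A m p → Shallow A n p
□ ⟪ T ⟫        = T
appˡ S u ⟪ T ⟫ = appˡ (S ⟪ T ⟫) u
appʳ u S ⟪ T ⟫ = appʳ u (S ⟪ T ⟫)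
es S u ⟪ T ⟫   = es (S ⟪ T ⟫) u

-- The index, inside the hole of S, of a variable from outside S.
weaken : Shallow A n m → Ren n m
weaken □          = id
weaken (appˡ S u) = weaken S
weaken (appʳ u S) = weaken S
weaken (es S u)   = weaken S ∘ suc

-- The scope of the hole of S once the free variables of S are replaced by
-- terms in scope i.
holeScope : Shallow A n m → ℕ → ℕ
holeScope □          i = i
holeScope (appˡ S u) i = holeScope S i
holeScope (appʳ u S) i = holeScope S i
holeScope (es S u)   i = holeScope S (suc i)

renameᶜ : Ren n p → (S : Shallow A n m) → Shallow A p (holeScope S p)
renameᶜ ρ □          = □
renameᶜ ρ (appˡ S u) = appˡ (renameᶜ ρ S) (rename ρ u)
renameᶜ ρ (appʳ u S) = appʳ (rename ρ u) (renameᶜ ρ S)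
renameᶜ ρ (es S u)   = es (renameᶜ (liftᴿ ρ) S) (rename ρ u)

subᶜ : Sub A withES n p → (S : Shallow A n m) → Shallow A p (holeScope S p)
subᶜ σ □          = □
subᶜ σ (appˡ S u) = appˡ (subᶜ σ S) (sub σ u)
subᶜ σ (appʳ u S) = appʳ (sub σ u) (subᶜ σ S)
subᶜ σ (es S u)   = es (subᶜ (liftˢ σ) S) (sub σ u)

infix 25 _↓[_]

_↓[_] : Term A withES m → Shallow A n m → Term A plain n
t ↓[ □ ]        = t ↓
t ↓[ appˡ S u ] = t ↓[ S ]
t ↓[ appʳ u S ] = t ↓[ S ]
t ↓[ es S u ]   = sub ⟨x← u ↓ ⟩ (t ↓[ S ])

data Evaluable {A : Set} : Shallow A n m → Set where
  □    : Evaluable (□ {n = n})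
  appˡ : ∀ {S : Shallow A n m} {t} → Evaluable S → Fireball (t ↓) →
         Evaluable (appˡ S t)
  appʳ : ∀ {t} {S : Shallow A n m} → Evaluable S → Evaluable (appʳ t S)
  es   : ∀ {S : Shallow A (suc n) m} {t} → Fireball (t ↓) →
         Evaluable (subᶜ ⟨x← ⌜ t ↓ ⌝ ⟩ S) → Evaluable (es S t)

Applicative : Shallow A n m → Set
Applicative {A} {n} {m} S =
  ∃[ i ] Σ[ S′ ∈ Shallow A n i ] Σ[ L ∈ SubCtx A i m ] ∃[ u ]
    S ≡ S′ ⟪ appˡ ⌊ L ⌋ u ⟫

Useful : Shallow A n m → Set
Useful S = Evaluable S × Applicative S

infix 4 _⊸um_ _⊸ue_

-- Moving L outwards over a term or context that was not in its scope is
-- weakening by L.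

data _⊸um_ {A : Set} {n : ℕ} : Rel (Term A withES n) 0ℓ where
  step : ∀ {m p} (S : Shallow A n m) (L : SubCtx A m p) t u →
         Useful (S ⟪ appˡ ⌊ L ⌋ u ⟫) →
         S ⟨ app (⌊ L ⌋ ⟨ lam t ⟩) u ⟩
           ⊸um
         S ⟨ ⌊ L ⌋ ⟨ es t (rename (weaken ⌊ L ⌋) u) ⟩ ⟩

-- The replaced variable is the one bound by the displayed es, hence index
-- zero outside S′; S″ is S′ moved under L.

data _⊸ue_ {A : Set} {n : ℕ} : Rel (Term A withES n) 0ℓ where
  step : ∀ {m p q} (S : Shallow A n m) (S′ : Shallow A (suc m) p)
         (L : SubCtx A m q) (u : Term A withES q) →
         Useful (S ⟪ es S′ (⌊ L ⌋ ⟨ u ⟩) ⟫) →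
         ¬ (∃[ u′ ] ∃[ w ] u ≡ es u′ w) →
         Value (u ↓[ S ⟪ ⌊ L ⌋ ⟫ ]) →
         let S″ = renameᶜ (liftᴿ (weaken ⌊ L ⌋)) S′ in
         S ⟨ es (S′ ⟨ var (weaken S′ zero) ⟩) (⌊ L ⌋ ⟨ u ⟩) ⟩
           ⊸ue
         S ⟨ ⌊ L ⌋ ⟨ es (S″ ⟨ rename (weaken S″ ∘ suc) u ⟩) u ⟩ ⟩

module _ {X : Set} where

  ∣_∣ : {R : Rel X 0ℓ} {x y : X} → Star R x y → ℕ
  ∣ ε ∣     = 0
  ∣ _ ◅ d ∣ = suc ∣ d ∣

  -- In a union of multiplicative and exponential steps, the multiplicative
  -- ones are on the left.
  ∣_∣ₘ : {M E : Rel X 0ℓ} {x y : X} → Star (M ∪ E) x y → ℕ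
  ∣ ε ∣ₘ          = 0
  ∣ inj₁ _ ◅ d ∣ₘ = suc ∣ d ∣ₘ
  ∣ inj₂ _ ◅ d ∣ₘ = ∣ d ∣ₘ

module _ {A : Set}
         (_⟶_ : ∀ {n} → Rel (Term A plain n) 0ℓ)
         (_⊸m_ _⊸e_ : ∀ {n} → Rel (Term A withES n) 0ℓ) where

  private
    _⊸_ : ∀ {n} → Rel (Term A withES n) 0ℓ
    _⊸_ = _⊸m_ ∪ _⊸e_

  record IsHighLevelImplementationSystem : Set where
    field
      ⟶-deterministic : ∀ {n} → Deterministic _≡_ (_⟶_ {n})
      ⊸-deterministic : ∀ {n} → Deterministic _≡_ (_⊸_ {n})
      normalForm      : ∀ {n} (t : Term A plain n) {u} → Star _⊸_ ⌜ t ⌝ u →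
                        IsNormalForm _⊸_ u → IsNormalForm _⟶_ (u ↓)
      projection      : ∀ {n} (t : Term A plain n) {u} (d : Star _⊸_ ⌜ t ⌝ u) →
                        Σ[ d↓ ∈ Star _⟶_ (⌜ t ⌝ ↓) (u ↓) ] ∣ d↓ ∣ ≡ ∣ d ∣ₘ

  record IsLocallyBoundedHighLevelImplementationSystem : Set where
    field
      isHighLevelImplementationSystem : IsHighLevelImplementationSystem
      locallyBounded :
        ∃[ c ] (∀ {n} (t : Term A plain n) {u} (d : Star _⊸_ ⌜ t ⌝ u) →
                ∀ {w} (e : Star _⊸e_ u w) → ∣ e ∣ ≤ c * ∣ d ∣ₘ)

    open IsHighLevelImplementationSystem isHighLevelImplementationSystem public

  QuadraticOverhead : IsHighLevelImplementationSystem → Set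
  QuadraticOverhead I =
    ∃[ c ] (∀ {n} (t : Term A plain n) {u} (d : Star _⊸_ ⌜ t ⌝ u) →
            ∣ d ∣ ≤ c * ∣ proj₁ (projection t d) ∣ ^ 2)
    where open IsHighLevelImplementationSystem I

{-# OPTIONS --safe #-}

-- Everything is read through the unfolding ⟦ t ⟧ σ of t in an environment σ of
-- plain terms, which the explicit substitutions met on the way to a hole extend.
-- A useful redex is an active position: an evaluable context whose hole is applied
-- and holds an abstraction or a variable whose environment entry is a value.  It
-- unfolds to the redex of the Fireball Calculus, so a term has at most one (a
-- fireball argument contains none), and multiplicative steps project to one step,
-- exponential steps to none.  From λ-terms, contents of explicit substitutions
-- unfold to fireballs and bodies of abstractions have no explicit substitutions.
-- Hence a redex of t ↓ comes from an active position of t, and the number of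
-- explicit substitutions of t is the number of multiplicative steps done.  An
-- exponential step makes the copied term the next active position; if it is again
-- a variable then its binder is further out, so exponential sequences are no longer
-- than the number of explicit substitutions.

module Submission where

open import Defs
open import Data.Bool.Base using (Bool; true; false)
open import Data.Empty using (⊥-elim)
open import Data.Fin.Base using (Fin; zero; suc)
open import Data.Maybe.Base using (Maybe; just; nothing)
open import Data.Maybe.Properties using (just-injective)
open import Data.Nat.Base using (ℕ; zero; suc; _+_; _*_; _^_; _≤_; _<_; z≤n; s≤s)
open import Data.Nat.Properties
open import Data.Nat.Tactic.RingSolver using (solve-∀)
open import Data.Product.Base using (Σ-syntax; ∃-syntax; _×_; _,_; proj₁; proj₂)
open import Data.Sum.Base using (_⊎_; inj₁; inj₂)
open import Data.Unit.Base using (⊤; tt)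
open import Data.Vec.Functional using (_∷_)
open import Function.Base using (_∘_; case_of_)
open import Level using (0ℓ)
open import Relation.Binary.Construct.Closure.ReflexiveTransitive using (Star; ε; _◅_; _◅◅_; map)
open import Relation.Binary.Construct.Union using (_∪_)
open import Relation.Binary.Core using (Rel)
open import Relation.Binary.PropositionalEquality
open import Relation.Binary.Rewriting using (Deterministic; IsNormalForm)
open import Relation.Nullary.Negation.Core using (¬_)

open IsLocallyBoundedHighLevelImplementationSystem using (isHighLevelImplementationSystem)

private
  variable
    A         : Set
    k         : Kind
    n m p q i : ℕ

-- Renaming and substitution of plain terms.

infixr 5 _•_

_•_ : Term A k m → Sub A k n m → Sub A k (suc n) m
(t • σ) zero    = t
(t • σ) (suc x) = σ x

•-cong : {t u : Term A k m} {σ τ : Sub A k n m} → t ≡ u → σ ≗ τ → t • σ ≗ u • τ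
•-cong t≡u σ≗τ zero    = t≡u
•-cong t≡u σ≗τ (suc x) = σ≗τ x

-- Here and below, a composite is a third map given by a pointwise equation, so that binder cases go
-- by matching on the index, without function extensionality.
rename-rename : {ρ : Ren n m} {ρ′ : Ren m p} {θ : Ren n p} →
                (∀ x → ρ′ (ρ x) ≡ θ x) → (t : Term A plain n) →
                rename ρ′ (rename ρ t) ≡ rename θ t
rename-rename eq (var x)   = cong var (eq x)
rename-rename eq (symb a)  = refl
rename-rename eq (lam t)   =
  cong lam (rename-rename (λ { zero → refl ; (suc x) → cong suc (eq x) }) t)
rename-rename eq (app t u) = cong₂ app (rename-rename eq t) (rename-rename eq u)

sub-rename : {ρ : Ren n m} {σ : Sub A plain m p} {τ : Sub A plain n p} →
             (∀ x → σ (ρ x) ≡ τ x) → ∀ t → sub σ (rename ρ t) ≡ sub τ t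
sub-rename eq (var x)   = eq x
sub-rename eq (symb a)  = refl
sub-rename eq (lam t)   =
  cong lam (sub-rename (λ { zero → refl ; (suc x) → cong (rename suc) (eq x) }) t)
sub-rename eq (app t u) = cong₂ app (sub-rename eq t) (sub-rename eq u)

rename-liftˢ : {ρ : Ren m p} {σ : Sub A plain n m} {τ : Sub A plain n p} →
               (∀ x → rename ρ (σ x) ≡ τ x) →
               ∀ x → rename (liftᴿ ρ) (liftˢ σ x) ≡ liftˢ τ x
rename-liftˢ eq zero    = refl
rename-liftˢ {σ = σ} eq (suc x) =
  trans (rename-rename (λ _ → refl) (σ x))
        (trans (sym (rename-rename (λ _ → refl) (σ x))) (cong (rename suc) (eq x)))

rename-sub : {ρ : Ren m p} {σ : Sub A plain n m} {τ : Sub A plain n p} →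
             (∀ x → rename ρ (σ x) ≡ τ x) → ∀ t → rename ρ (sub σ t) ≡ sub τ t
rename-sub eq (var x)   = eq x
rename-sub eq (symb a)  = refl
rename-sub eq (lam t)   = cong lam (rename-sub (rename-liftˢ eq) t)
rename-sub eq (app t u) = cong₂ app (rename-sub eq t) (rename-sub eq u)

liftˢ-var : {σ : Sub A k n n} → σ ≗ var → liftˢ σ ≗ var
liftˢ-var eq zero    = refl
liftˢ-var eq (suc x) = cong (rename suc) (eq x)

sub-id : {σ : Sub A plain n n} → σ ≗ var → ∀ t → sub σ t ≡ t
sub-id eq (var x)   = eq x
sub-id eq (symb a)  = refl
sub-id eq (lam t)   = cong lam (sub-id (liftˢ-var eq) t)
sub-id eq (app t u) = cong₂ app (sub-id eq t) (sub-id eq u)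

-- Unfolding in an environment

⟦_⟧ : Term A withES n → Sub A plain n m → Term A plain m
⟦ var x ⟧   σ = σ x
⟦ symb a ⟧  σ = symb a
⟦ lam t ⟧   σ = lam (⟦ t ⟧ (liftˢ σ))
⟦ app t u ⟧ σ = app (⟦ t ⟧ σ) (⟦ u ⟧ σ)
⟦ es t u ⟧  σ = ⟦ t ⟧ (⟦ u ⟧ σ • σ)

⟦⟧-cong : (t : Term A withES n) {σ τ : Sub A plain n m} → σ ≗ τ → ⟦ t ⟧ σ ≡ ⟦ t ⟧ τ
⟦⟧-cong (var x)   eq = eq x
⟦⟧-cong (symb a)  eq = refl
⟦⟧-cong (lam t)   eq =
  cong lam (⟦⟧-cong t (λ { zero → refl ; (suc x) → cong (rename suc) (eq x) }))
⟦⟧-cong (app t u) eq = cong₂ app (⟦⟧-cong t eq) (⟦⟧-cong u eq)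
⟦⟧-cong (es t u)  eq = ⟦⟧-cong t (•-cong (⟦⟧-cong u eq) eq)

⟦⟧-rename : (t : Term A withES n) {ρ : Ren n m} {σ : Sub A plain m p} {τ : Sub A plain n p} →
            (∀ x → σ (ρ x) ≡ τ x) → ⟦ rename ρ t ⟧ σ ≡ ⟦ t ⟧ τ
⟦⟧-rename (var x)   eq = eq x
⟦⟧-rename (symb a)  eq = refl
⟦⟧-rename (lam t)   eq =
  cong lam (⟦⟧-rename t (λ { zero → refl ; (suc x) → cong (rename suc) (eq x) }))
⟦⟧-rename (app t u) eq = cong₂ app (⟦⟧-rename t eq) (⟦⟧-rename u eq)
⟦⟧-rename (es t u)  eq =
  ⟦⟧-rename t (λ { zero → ⟦⟧-rename u eq ; (suc x) → eq x })

rename-⟦⟧ : (t : Term A withES n) {ρ : Ren m p} {σ : Sub A plain n m} {τ : Sub A plain n p} →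
            (∀ x → rename ρ (σ x) ≡ τ x) → rename ρ (⟦ t ⟧ σ) ≡ ⟦ t ⟧ τ
rename-⟦⟧ (var x)   eq = eq x
rename-⟦⟧ (symb a)  eq = refl
rename-⟦⟧ (lam t)   eq = cong lam (rename-⟦⟧ t (rename-liftˢ eq))
rename-⟦⟧ (app t u) eq = cong₂ app (rename-⟦⟧ t eq) (rename-⟦⟧ u eq)
rename-⟦⟧ (es t u)  eq =
  rename-⟦⟧ t (λ { zero → rename-⟦⟧ u eq ; (suc x) → eq x })

sub-⟦⟧ : (t : Term A withES n) {ρ : Sub A plain m p} {σ : Sub A plain n m} {τ : Sub A plain n p} →
         (∀ x → sub ρ (σ x) ≡ τ x) → sub ρ (⟦ t ⟧ σ) ≡ ⟦ t ⟧ τ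
sub-⟦⟧ (var x)   eq = eq x
sub-⟦⟧ (symb a)  eq = refl
sub-⟦⟧ (lam t)   {σ = σ} eq = cong lam (sub-⟦⟧ t λ
  { zero    → refl
  ; (suc x) → trans (sub-rename (λ _ → refl) (σ x))
                (trans (sym (rename-sub (λ _ → refl) (σ x))) (cong (rename suc) (eq x))) })
sub-⟦⟧ (app t u) eq = cong₂ app (sub-⟦⟧ t eq) (sub-⟦⟧ u eq)
sub-⟦⟧ (es t u)  eq = sub-⟦⟧ t (λ { zero → sub-⟦⟧ u eq ; (suc x) → eq x })

⟦⟧-sub : (t : Term A withES n) {τ : Sub A withES n m} {σ : Sub A plain m p} {υ : Sub A plain n p} →
         (∀ x → ⟦ τ x ⟧ σ ≡ υ x) → ⟦ sub τ t ⟧ σ ≡ ⟦ t ⟧ υ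
⟦⟧-sub (var x)   eq = eq x
⟦⟧-sub (symb a)  eq = refl
⟦⟧-sub (lam t)   {τ} eq = cong lam (⟦⟧-sub t λ
  { zero    → refl
  ; (suc x) → trans (⟦⟧-rename (τ x) (λ _ → refl))
                (trans (sym (rename-⟦⟧ (τ x) (λ _ → refl))) (cong (rename suc) (eq x))) })
⟦⟧-sub (app t u) eq = cong₂ app (⟦⟧-sub t eq) (⟦⟧-sub u eq)
⟦⟧-sub (es t u)  {τ} eq = ⟦⟧-sub t λ
  { zero    → ⟦⟧-sub u eq
  ; (suc x) → trans (⟦⟧-rename (τ x) (λ _ → refl)) (eq x) }

-- Why a β-step agrees with the creation of an explicit substitution: contracting an abstraction
-- unfolded under `liftˢ σ` unfolds its body in `u • σ`.
sub-⟨x←⟩-liftˢ : (u : Term A plain m) (σ : Sub A plain n m) →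
                 ∀ x → sub ⟨x← u ⟩ (liftˢ σ x) ≡ (u • σ) x
sub-⟨x←⟩-liftˢ u σ zero    = refl
sub-⟨x←⟩-liftˢ u σ (suc x) =
  trans (sub-rename (λ _ → refl) (σ x)) (sub-id (λ _ → refl) (σ x))

-- Stated for any `σ` pointwise equal to `var`, because under a binder the environment becomes
-- `liftˢ σ`.
↓-⟦⟧ : (t : Term A withES n) {σ : Sub A plain n n} → σ ≗ var → ⟦ t ⟧ σ ≡ t ↓
↓-⟦⟧ (var x)   eq = eq x
↓-⟦⟧ (symb a)  eq = refl
↓-⟦⟧ (lam t)   eq = cong lam (↓-⟦⟧ t (liftˢ-var eq))
↓-⟦⟧ (app t u) eq = cong₂ app (↓-⟦⟧ t eq) (↓-⟦⟧ u eq)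
↓-⟦⟧ (es t u)  eq = trans (sym (sub-⟦⟧ t λ
    { zero    → sym (↓-⟦⟧ u eq)
    ; (suc x) → sym (eq x) }))
  (cong (sub ⟨x← u ↓ ⟩) (↓-⟦⟧ t (λ _ → refl)))

sub-↓ : (t : Term A withES n) (σ : Sub A plain n m) → sub σ (t ↓) ≡ ⟦ t ⟧ σ
sub-↓ t σ = trans (cong (sub σ) (sym (↓-⟦⟧ t (λ _ → refl)))) (sub-⟦⟧ t (λ _ → refl))

↓-sub : (t : Term A withES n) (τ : Sub A withES n m) → (sub τ t) ↓ ≡ ⟦ t ⟧ (_↓ ∘ τ)
↓-sub t τ = trans (sym (↓-⟦⟧ (sub τ t) (λ _ → refl)))
                  (⟦⟧-sub t (λ x → ↓-⟦⟧ (τ x) (λ _ → refl)))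

↓-rename : (ρ : Ren n m) (t : Term A withES n) → (rename ρ t) ↓ ≡ rename ρ (t ↓)
↓-rename ρ t = begin
  (rename ρ t) ↓         ≡⟨ ↓-⟦⟧ (rename ρ t) (λ _ → refl) ⟨
  ⟦ rename ρ t ⟧ var     ≡⟨ ⟦⟧-rename t (λ _ → refl) ⟩
  ⟦ t ⟧ (var ∘ ρ)        ≡⟨ rename-⟦⟧ t (λ _ → refl) ⟨
  rename ρ (⟦ t ⟧ var)   ≡⟨ cong (rename ρ) (↓-⟦⟧ t (λ _ → refl)) ⟩
  rename ρ (t ↓)         ∎
  where open ≡-Reasoning

-- Environments at the hole of a context.

env : Sub A plain n p → Shallow A n m → Sub A plain m p
env σ □          = σ
env σ (appˡ S u) = env σ S
env σ (appʳ u S) = env σ S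
env σ (es S u)   = env (⟦ u ⟧ σ • σ) S

env-⟪⟫ : (σ : Sub A plain n p) (S : Shallow A n m) (T : Shallow A m q) →
         env σ (S ⟪ T ⟫) ≡ env (env σ S) T
env-⟪⟫ σ □          T = refl
env-⟪⟫ σ (appˡ S u) T = env-⟪⟫ σ S T
env-⟪⟫ σ (appʳ u S) T = env-⟪⟫ σ S T
env-⟪⟫ σ (es S u)   T = env-⟪⟫ _ S T

env-weaken : (σ : Sub A plain n p) (S : Shallow A n m) → ∀ x → env σ S (weaken S x) ≡ σ x
env-weaken σ □          x = refl
env-weaken σ (appˡ S u) x = env-weaken σ S x
env-weaken σ (appʳ u S) x = env-weaken σ S x
env-weaken σ (es S u)   x = env-weaken _ S (suc x)

sub-env : (S : Shallow A n m) {ρ : Sub A plain p q} {σ : Sub A plain n p} {τ : Sub A plain n q} →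
          (∀ x → sub ρ (σ x) ≡ τ x) → ∀ x → sub ρ (env σ S x) ≡ env τ S x
sub-env □          eq = eq
sub-env (appˡ S u) eq = sub-env S eq
sub-env (appʳ u S) eq = sub-env S eq
sub-env (es S u)   eq = sub-env S (λ { zero → sub-⟦⟧ u eq ; (suc x) → eq x })

-- Turns the value condition of the exponential rule into one on environments. `_↓[_]` substitutes
-- from the inside out while `env` extends from the outside in; `sub-env` reconciles the two.
↓[]-⟦⟧ : (S : Shallow A n m) (t : Term A withES m) → t ↓[ S ] ≡ ⟦ t ⟧ (env var S)
↓[]-⟦⟧ □          t = sym (↓-⟦⟧ t (λ _ → refl))
↓[]-⟦⟧ (appˡ S u) t = ↓[]-⟦⟧ S t
↓[]-⟦⟧ (appʳ u S) t = ↓[]-⟦⟧ S t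
↓[]-⟦⟧ (es S u)   t = trans (cong (sub ⟨x← u ↓ ⟩) (↓[]-⟦⟧ S t))
  (sub-⟦⟧ t (sub-env S λ { zero → sym (↓-⟦⟧ u (λ _ → refl)) ; (suc x) → refl }))

⟦⟧-plug-cong : (S : Shallow A n m) (t u : Term A withES m) {σ : Sub A plain n p} →
               ⟦ t ⟧ (env σ S) ≡ ⟦ u ⟧ (env σ S) → ⟦ S ⟨ t ⟩ ⟧ σ ≡ ⟦ S ⟨ u ⟩ ⟧ σ
⟦⟧-plug-cong □          t u eq = eq
⟦⟧-plug-cong (appˡ S v) t u eq = cong₂ app (⟦⟧-plug-cong S t u eq) refl
⟦⟧-plug-cong (appʳ v S) t u eq = cong (app _) (⟦⟧-plug-cong S t u eq)
⟦⟧-plug-cong (es S v)   t u eq = ⟦⟧-plug-cong S t u eq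

⟦⟧-plug-sub : (L : SubCtx A n m) (t : Term A withES m) (σ : Sub A plain n p) →
              ⟦ ⌊ L ⌋ ⟨ t ⟩ ⟧ σ ≡ ⟦ t ⟧ (env σ ⌊ L ⌋)
⟦⟧-plug-sub □        t σ = refl
⟦⟧-plug-sub (es L u) t σ = ⟦⟧-plug-sub L t _

-- Serves the exponential rule, where `S′` is renamed as it moves under `L` and the content of its
-- hole changes at the same time.
⟦⟧-plug-rename : (S : Shallow A n m) {ρ : Ren n p} {σ : Sub A plain p q} {τ : Sub A plain n q}
                 {t : Term A withES m} {u : Term A withES (holeScope S p)} →
                 (∀ x → σ (ρ x) ≡ τ x) →
                 ⟦ u ⟧ (env σ (renameᶜ ρ S)) ≡ ⟦ t ⟧ (env τ S) →
                 ⟦ renameᶜ ρ S ⟨ u ⟩ ⟧ σ ≡ ⟦ S ⟨ t ⟩ ⟧ τ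
⟦⟧-plug-rename □          eq h = h
⟦⟧-plug-rename (appˡ S v) eq h = cong₂ app (⟦⟧-plug-rename S eq h) (⟦⟧-rename v eq)
⟦⟧-plug-rename (appʳ v S) eq h = cong₂ app (⟦⟧-rename v eq) (⟦⟧-plug-rename S eq h)
⟦⟧-plug-rename (es S v)   eq h =
  ⟦⟧-plug-rename S (λ { zero → ⟦⟧-rename v eq ; (suc x) → eq x }) h

-- Evaluability relative to an environment

-- `Evaluable` substitutes each content into the rest of the context; recording it in the
-- environment instead makes the condition structural in `S`.
Eval : Sub A plain n p → Shallow A n m → Set
Eval σ □          = ⊤
Eval σ (appˡ S u) = Eval σ S × Fireball (⟦ u ⟧ σ)
Eval σ (appʳ u S) = Eval σ S
Eval σ (es S u)   = Fireball (⟦ u ⟧ σ) × Eval (⟦ u ⟧ σ • σ) S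

-- Inst σ S T says that T is S with σ substituted in it, up to unfolding; unlike
-- an equation T ≡ subᶜ τ S, it does not constrain the scope of the hole of T.
data Inst {A : Set} : Sub A plain n p → Shallow A n m → Shallow A p q → Set where
  □    : {σ : Sub A plain n p} → Inst σ □ □
  appˡ : ∀ {σ : Sub A plain n p} {S : Shallow A n m} {T : Shallow A p q} {u v} →
         Inst σ S T → ⟦ u ⟧ σ ≡ v ↓ → Inst σ (appˡ S u) (appˡ T v)
  appʳ : ∀ {σ : Sub A plain n p} {S : Shallow A n m} {T : Shallow A p q} {u v} →
         Inst σ S T → Inst σ (appʳ u S) (appʳ v T)
  es   : ∀ {σ : Sub A plain n p} {S : Shallow A (suc n) m} {T : Shallow A (suc p) q} {u v} →
         Inst (liftˢ σ) S T → ⟦ u ⟧ σ ≡ v ↓ → Inst σ (es S u) (es T v)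

Inst-refl : (S : Shallow A n m) {σ : Sub A plain n n} → σ ≗ var → Inst σ S S
Inst-refl □          eq = □
Inst-refl (appˡ S u) eq = appˡ (Inst-refl S eq) (↓-⟦⟧ u eq)
Inst-refl (appʳ u S) eq = appʳ (Inst-refl S eq)
Inst-refl (es S u)   eq = es (Inst-refl S (liftˢ-var eq)) (↓-⟦⟧ u eq)

⟦⟧-instance : (u : Term A withES n) (v : Term A withES p) {σ : Sub A plain n p}
              {τ : Sub A withES p q} {υ : Sub A plain n q} → ⟦ u ⟧ σ ≡ v ↓ →
              (∀ x → sub (_↓ ∘ τ) (σ x) ≡ υ x) → ⟦ u ⟧ υ ≡ (sub τ v) ↓
⟦⟧-instance u v {σ} {τ} {υ} u≡v eq = begin
  ⟦ u ⟧ υ                    ≡⟨ sub-⟦⟧ u eq ⟨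
  sub (_↓ ∘ τ) (⟦ u ⟧ σ)     ≡⟨ cong (sub (_↓ ∘ τ)) u≡v ⟩
  sub (_↓ ∘ τ) (v ↓)         ≡⟨ sub-↓ v (_↓ ∘ τ) ⟩
  ⟦ v ⟧ (_↓ ∘ τ)             ≡⟨ ↓-sub v τ ⟨
  (sub τ v) ↓                ∎
  where open ≡-Reasoning

Inst-sub : {S : Shallow A n m} {T : Shallow A p q} {σ : Sub A plain n p}
           {τ : Sub A withES p i} {υ : Sub A plain n i} → Inst σ S T →
           (∀ x → sub (_↓ ∘ τ) (σ x) ≡ υ x) → Inst υ S (subᶜ τ T)
Inst-sub □                    eq = □
Inst-sub (appˡ {u = u} {v} I e) eq = appˡ (Inst-sub I eq) (⟦⟧-instance u v e eq)
Inst-sub (appʳ I)             eq = appʳ (Inst-sub I eq)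
Inst-sub {τ = τ} (es {σ = σ} {u = u} {v} I e) eq = es (Inst-sub I λ
    { zero    → refl
    ; (suc x) → trans (sub-rename (λ y → ↓-rename suc (τ y)) (σ x))
                  (trans (sym (rename-sub (λ _ → refl) (σ x))) (cong (rename suc) (eq x))) })
  (⟦⟧-instance u v e eq)

-- Crossing a substitution: what evaluability substitutes into `T` is, on the side of `S`, one more
-- entry of the environment.
Inst-open : {S : Shallow A (suc n) m} {T : Shallow A (suc p) q} {σ : Sub A plain n p}
            (u : Term A withES n) (v : Term A withES p) → Inst (liftˢ σ) S T → ⟦ u ⟧ σ ≡ v ↓ →
            Inst (⟦ u ⟧ σ • σ) S (subᶜ ⟨x← ⌜ v ↓ ⌝ ⟩ T)
Inst-open {σ = σ} u v I e = Inst-sub I λ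
  { zero    → trans (⌜⌝-↓ (v ↓)) (sym e)
  ; (suc x) → trans (sub-rename (λ _ → refl) (σ x)) (sub-id (λ _ → refl) (σ x)) }

Evaluable⇒Eval-Inst : {S : Shallow A n m} {T : Shallow A p q} {σ : Sub A plain n p} →
                      Inst σ S T → Evaluable T → Eval σ S
Evaluable⇒Eval-Inst □          □          = tt
Evaluable⇒Eval-Inst (appˡ I e) (appˡ E f) =
  Evaluable⇒Eval-Inst I E , subst Fireball (sym e) f
Evaluable⇒Eval-Inst (appʳ I)   (appʳ E)   = Evaluable⇒Eval-Inst I E
Evaluable⇒Eval-Inst (es {u = u} {v} I e) (es f E) =
  subst Fireball (sym e) f , Evaluable⇒Eval-Inst (Inst-open u v I e) E

-- Recursion is on `S`, which shrinks when a substitution is crossed, whereas `T` gives way to a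
-- substitution instance of its body.
Eval⇒Evaluable-Inst : (S : Shallow A n m) {T : Shallow A p q} {σ : Sub A plain n p} →
                      Inst σ S T → Eval σ S → Evaluable T
Eval⇒Evaluable-Inst □          □          _       = □
Eval⇒Evaluable-Inst (appˡ S u) (appˡ I e) (E , f) =
  appˡ (Eval⇒Evaluable-Inst S I E) (subst Fireball e f)
Eval⇒Evaluable-Inst (appʳ u S) (appʳ I)   E       = appʳ (Eval⇒Evaluable-Inst S I E)
Eval⇒Evaluable-Inst (es S u)   (es {v = v} I e) (f , E) =
  es (subst Fireball e f) (Eval⇒Evaluable-Inst S (Inst-open u v I e) E)

Evaluable⇒Eval : (S : Shallow A n m) → Evaluable S → Eval var S
Evaluable⇒Eval S = Evaluable⇒Eval-Inst (Inst-refl S (λ _ → refl))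

Eval⇒Evaluable : (S : Shallow A n m) → Eval var S → Evaluable S
Eval⇒Evaluable S = Eval⇒Evaluable-Inst S (Inst-refl S (λ _ → refl))

Eval-⟪⟫⁺ : (S : Shallow A n m) {T : Shallow A m q} {σ : Sub A plain n p} →
           Eval σ S → Eval (env σ S) T → Eval σ (S ⟪ T ⟫)
Eval-⟪⟫⁺ □          _       E′ = E′
Eval-⟪⟫⁺ (appˡ S u) (E , f) E′ = Eval-⟪⟫⁺ S E E′ , f
Eval-⟪⟫⁺ (appʳ u S) E       E′ = Eval-⟪⟫⁺ S E E′
Eval-⟪⟫⁺ (es S u)   (f , E) E′ = f , Eval-⟪⟫⁺ S E E′

Eval-⟪⟫⁻ : (S : Shallow A n m) {T : Shallow A m q} {σ : Sub A plain n p} →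
           Eval σ (S ⟪ T ⟫) → Eval σ S × Eval (env σ S) T
Eval-⟪⟫⁻ □          E       = tt , E
Eval-⟪⟫⁻ (appˡ S u) (E , f) = let E₁ , E₂ = Eval-⟪⟫⁻ S E in (E₁ , f) , E₂
Eval-⟪⟫⁻ (appʳ u S) E       = Eval-⟪⟫⁻ S E
Eval-⟪⟫⁻ (es S u)   (f , E) = let E₁ , E₂ = Eval-⟪⟫⁻ S E in (f , E₁) , E₂

Eval-rename : (S : Shallow A n m) {ρ : Ren n p} {σ : Sub A plain p q} {τ : Sub A plain n q} →
              (∀ x → σ (ρ x) ≡ τ x) → Eval τ S → Eval σ (renameᶜ ρ S)
Eval-rename □          eq _       = tt
Eval-rename (appˡ S u) eq (E , f) =
  Eval-rename S eq E , subst Fireball (sym (⟦⟧-rename u eq)) f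
Eval-rename (appʳ u S) eq E       = Eval-rename S eq E
Eval-rename (es S u)   eq (f , E) =
  subst Fireball (sym (⟦⟧-rename u eq)) f ,
  Eval-rename S (λ { zero → ⟦⟧-rename u eq ; (suc x) → eq x }) E

-- applied b S tells whether the hole of S is applied, b telling whether S is.
applied : Bool → Shallow A n m → Bool
applied b □          = b
applied b (appˡ S u) = applied true S
applied b (appʳ u S) = applied false S
applied b (es S u)   = applied b S

applied-⟪⟫ : ∀ b (S : Shallow A n m) (T : Shallow A m p) →
             applied b (S ⟪ T ⟫) ≡ applied (applied b S) T
applied-⟪⟫ b □          T = refl
applied-⟪⟫ b (appˡ S u) T = applied-⟪⟫ true S T
applied-⟪⟫ b (appʳ u S) T = applied-⟪⟫ false S T
applied-⟪⟫ b (es S u)   T = applied-⟪⟫ b S T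

applied-sub : ∀ b (L : SubCtx A n m) → applied b ⌊ L ⌋ ≡ b
applied-sub b □        = refl
applied-sub b (es L u) = applied-sub b L

applied-rename : ∀ b (S : Shallow A n m) {ρ : Ren n p} → applied b (renameᶜ ρ S) ≡ applied b S
applied-rename b □          = refl
applied-rename b (appˡ S u) = applied-rename true S
applied-rename b (appʳ u S) = applied-rename false S
applied-rename b (es S u)   = applied-rename b S

Applicative⇒applied : (S : Shallow A n m) → Applicative S → applied false S ≡ true
Applicative⇒applied _ (_ , S , L , u , refl) =
  trans (applied-⟪⟫ false S (appˡ ⌊ L ⌋ u)) (applied-sub true L)

-- The Fireball Calculus

infix 4 _⇒_

-- `_→f_` with the evaluation context absorbed into the rules, so that steps can be analysed by
-- matching rather than through equations between plugged terms.
data _⇒_ {A : Set} {n : ℕ} : Rel (Term A plain n) 0ℓ where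
  β    : ∀ {t f} → Fireball f → app (lam t) f ⇒ sub ⟨x← f ⟩ t
  appʳ : ∀ {t u u′} → u ⇒ u′ → app t u ⇒ app t u′
  appˡ : ∀ {t t′ f} → t ⇒ t′ → Fireball f → app t f ⇒ app t′ f

→f⇒⇒ : {t u : Term A plain n} → t →f u → t ⇒ u
→f⇒⇒ (step F t f φ) = go F
  where
  go : ∀ F → plugᶠ F (app (lam t) f) ⇒ plugᶠ F (sub ⟨x← f ⟩ t)
  go □            = β φ
  go (appʳ u F)   = appʳ (go F)
  go (appˡ F g ψ) = appˡ (go F) ψ

⇒⇒→f : {t u : Term A plain n} → t ⇒ u → t →f u
⇒⇒→f (β φ)     = step □ _ _ φ
⇒⇒→f (appʳ r)   with ⇒⇒→f r
... | step F t f φ = step (appʳ _ F) t f φ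
⇒⇒→f (appˡ r ψ) with ⇒⇒→f r
... | step F t f φ = step (appˡ F _ ψ) t f φ

Irreducible : Term A plain n → Set
Irreducible t = ∀ {u} → ¬ (t ⇒ u)

fireball-irreducible : {t : Term A plain n} → Fireball t → Irreducible t
fireball-irreducible (inert (app () _)) (β _)
fireball-irreducible (inert (app _ f))  (appʳ r)   = fireball-irreducible f r
fireball-irreducible (inert (app i _))  (appˡ r _) = fireball-irreducible (inert i) r

-- `β` and `appˡ` both require a fireball argument, which is irreducible, so neither can compete
-- with `appʳ`; and an abstraction has no step for `appˡ` to use.
⇒-deterministic : {t u v : Term A plain n} → t ⇒ u → t ⇒ v → u ≡ v
⇒-deterministic (β _)       (β _)      = refl
⇒-deterministic (β f)       (appʳ r)   = ⊥-elim (fireball-irreducible f r)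
⇒-deterministic (appʳ r)    (β f)      = ⊥-elim (fireball-irreducible f r)
⇒-deterministic (appʳ r)    (appʳ s)   = cong (app _) (⇒-deterministic r s)
⇒-deterministic (appʳ r)    (appˡ _ f) = ⊥-elim (fireball-irreducible f r)
⇒-deterministic (appˡ _ f)  (appʳ r)   = ⊥-elim (fireball-irreducible f r)
⇒-deterministic (appˡ r _)  (appˡ s _) = cong₂ app (⇒-deterministic r s) refl

→f-deterministic : Deterministic _≡_ (_→f_ {A} {n})
→f-deterministic r s = ⇒-deterministic (→f⇒⇒ r) (→f⇒⇒ s)

⇒-app⁻ : {t u r : Term A plain n} → app t u ⇒ r →
         (Value t × Fireball u) ⊎ (∃[ u′ ] u ⇒ u′) ⊎ ((∃[ t′ ] t ⇒ t′) × Fireball u)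
⇒-app⁻ (β f)      = inj₁ (lam , f)
⇒-app⁻ (appʳ r)   = inj₂ (inj₁ (_ , r))
⇒-app⁻ (appˡ r f) = inj₂ (inj₂ ((_ , r) , f))

-- Evaluability supplies exactly the fireball arguments that `appˡ` asks for, and explicit
-- substitutions on the path vanish into the environment.
⇒-plug : (S : Shallow A n m) (t u : Term A withES m) {σ : Sub A plain n p} → Eval σ S →
         ⟦ t ⟧ (env σ S) ⇒ ⟦ u ⟧ (env σ S) → ⟦ S ⟨ t ⟩ ⟧ σ ⇒ ⟦ S ⟨ u ⟩ ⟧ σ
⇒-plug □          t u E       r = r
⇒-plug (appˡ S v) t u (E , f) r = appˡ (⇒-plug S t u E r) f
⇒-plug (appʳ v S) t u E       r = appʳ (⇒-plug S t u E r)
⇒-plug (es S v)   t u (f , E) r = ⇒-plug S t u E r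

-- Projection

um-redex um-reduct : SubCtx A n m → Term A withES (suc m) → Term A withES n → Term A withES n
um-redex  L t u = app (⌊ L ⌋ ⟨ lam t ⟩) u
um-reduct L t u = ⌊ L ⌋ ⟨ es t (rename (weaken ⌊ L ⌋) u) ⟩

⟦⟧-um : (L : SubCtx A n m) (t : Term A withES (suc m)) (u : Term A withES n)
        (τ : Sub A plain n p) → Fireball (⟦ u ⟧ τ) →
        ⟦ um-redex L t u ⟧ τ ⇒ ⟦ um-reduct L t u ⟧ τ
⟦⟧-um L t u τ f = subst₂ _⇒_
  (cong₂ app (sym (⟦⟧-plug-sub L (lam t) τ)) refl)
  -- Contraction extends the environment of the body by the unfolding of `u`, which is unchanged
  -- when `u` is weakened past `L`.
  (trans (sub-⟦⟧ t (λ x → trans (sub-⟨x←⟩-liftˢ (⟦ u ⟧ τ) (env τ ⌊ L ⌋) x)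
            (•-cong (sym (⟦⟧-rename u (env-weaken τ ⌊ L ⌋))) (λ _ → refl) x)))
         (sym (⟦⟧-plug-sub L (es t (rename (weaken ⌊ L ⌋) u)) τ)))
  (β f)

um-projects : {t u : Term A withES n} → t ⊸um u → t ↓ →f u ↓
um-projects (step S L t u (E , _)) with Eval-⟪⟫⁻ S (Evaluable⇒Eval _ E)
... | E₁ , _ , f = ⇒⇒→f (subst₂ _⇒_
  (↓-⟦⟧ (S ⟨ um-redex L t u ⟩) (λ _ → refl)) (↓-⟦⟧ (S ⟨ um-reduct L t u ⟩) (λ _ → refl))
  (⇒-plug S (um-redex L t u) (um-reduct L t u) E₁ (⟦⟧-um L t u (env var S) f)))

ue-redex ue-reduct : Shallow A (suc n) m → SubCtx A n p → Term A withES p → Term A withES n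
ue-redex  S L u = es (S ⟨ var (weaken S zero) ⟩) (⌊ L ⌋ ⟨ u ⟩)
ue-reduct S L u = ⌊ L ⌋ ⟨ es (S″ ⟨ rename (weaken S″ ∘ suc) u ⟩) u ⟩
  where S″ = renameᶜ (liftᴿ (weaken ⌊ L ⌋)) S

-- Moving the list L of substitutions out of the content of [x←L⟨u⟩] turns the
-- environment ⟦L⟨u⟩⟧τ • τ of S′ into ⟦u⟧τ′ • τ′, where τ′ extends τ with L.
env-ue : (L : SubCtx A n m) (u : Term A withES m) (τ : Sub A plain n p) →
         let τ′ = env τ ⌊ L ⌋ in
         ∀ x → (⟦ u ⟧ τ′ • τ′) (liftᴿ (weaken ⌊ L ⌋) x) ≡ (⟦ ⌊ L ⌋ ⟨ u ⟩ ⟧ τ • τ) x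
env-ue L u τ zero    = sym (⟦⟧-plug-sub L u τ)
env-ue L u τ (suc x) = env-weaken τ ⌊ L ⌋ x

-- The replaced variable already unfolds to its environment entry, which is the unfolding of the
-- copied `u`.
⟦⟧-ue : (S : Shallow A (suc n) m) (L : SubCtx A n p) (u : Term A withES p) (τ : Sub A plain n q) →
        ⟦ ue-redex S L u ⟧ τ ≡ ⟦ ue-reduct S L u ⟧ τ
⟦⟧-ue S L u τ = sym (trans (⟦⟧-plug-sub L (es (S″ ⟨ rename (weaken S″ ∘ suc) u ⟩) u) τ)
  (⟦⟧-plug-rename S (env-ue L u τ)
    (trans (⟦⟧-rename u (λ x → env-weaken _ S″ (suc x)))
           (sym (trans (env-weaken _ S zero) (⟦⟧-plug-sub L u τ))))))
  where S″ = renameᶜ (liftᴿ (weaken ⌊ L ⌋)) S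

ue-projects : {t u : Term A withES n} → t ⊸ue u → t ↓ ≡ u ↓
ue-projects (step S S′ L u _ _ _) = begin
  (S ⟨ ue-redex S′ L u ⟩) ↓         ≡⟨ ↓-⟦⟧ (S ⟨ ue-redex S′ L u ⟩) (λ _ → refl) ⟨
  ⟦ S ⟨ ue-redex S′ L u ⟩ ⟧ var     ≡⟨ ⟦⟧-plug-cong S (ue-redex S′ L u) (ue-reduct S′ L u)
                                         (⟦⟧-ue S′ L u (env var S)) ⟩
  ⟦ S ⟨ ue-reduct S′ L u ⟩ ⟧ var    ≡⟨ ↓-⟦⟧ (S ⟨ ue-reduct S′ L u ⟩) (λ _ → refl) ⟩
  (S ⟨ ue-reduct S′ L u ⟩) ↓        ∎
  where open ≡-Reasoning

uf-projects : {t u : Term A withES n} (d : Star (_⊸um_ ∪ _⊸ue_) t u) →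
              Σ[ d↓ ∈ Star _→f_ (t ↓) (u ↓) ] ∣ d↓ ∣ ≡ ∣ d ∣ₘ
uf-projects ε            = ε , refl
uf-projects (inj₁ r ◅ d) = let d↓ , eq = uf-projects d in um-projects r ◅ d↓ , cong suc eq
uf-projects (inj₂ r ◅ d) =
  subst (λ z → Σ[ d↓ ∈ Star _→f_ z _ ] ∣ d↓ ∣ ≡ ∣ d ∣ₘ) (sym (ue-projects r)) (uf-projects d)

-- Active positions

NotES : Term A withES n → Set
NotES u = ¬ (∃[ u′ ] ∃[ w ] u ≡ es u′ w)

data Atom {A : Set} {m p : ℕ} (τ : Sub A plain m p) : Term A withES m → Set where
  lam : ∀ {t} → Atom τ (lam t)
  var : ∀ {x} → Value (τ x) → Atom τ (var x)

atom-value : {τ : Sub A plain m p} {h : Term A withES m} → Atom τ h → Value (⟦ h ⟧ τ)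
atom-value lam     = lam
atom-value (var v) = v

-- Symbols and applications never unfold to an abstraction.
value-atom : {τ : Sub A plain m p} (h : Term A withES m) → NotES h → Value (⟦ h ⟧ τ) → Atom τ h
value-atom (var x)   _ v = var v
value-atom (lam h)   _ _ = lam
value-atom (es t u)  ¬es _ = ⊥-elim (¬es (t , u , refl))

-- The redex at (C , h) is multiplicative if h is an abstraction and exponential if
-- h is a variable.
record Active (b : Bool) (σ : Sub A plain n p) (t : Term A withES n)
              (C : Shallow A n m) (h : Term A withES m) : Set where
  constructor active
  field
    plugged    : C ⟨ h ⟩ ≡ t
    evaluable  : Eval σ C
    is-applied : applied b C ≡ true
    atom       : Atom (env σ C) h

open Active

-- The scope of the hole is bundled in, so that positions with different hole scopes can be compared
-- by an ordinary equation.
Located : Set → ℕ → Set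
Located A n = Σ[ m ∈ ℕ ] Shallow A n m × Term A withES m

mutual
  -- Heads of applications inside an inert are themselves inert, hence never values. The version for
  -- fireballs starts from `false`, which rules out the empty context, where the fireball could be
  -- the value itself.
  applied-not-inert : ∀ {b} (C : Shallow A n m) {h} {σ : Sub A plain n p} →
    applied b C ≡ true → Value (⟦ h ⟧ (env σ C)) → ¬ Inert (⟦ C ⟨ h ⟩ ⟧ σ)
  applied-not-inert □          {h} {σ} ap v i with ⟦ h ⟧ σ
  applied-not-inert □          ap lam () | _
  applied-not-inert (appˡ C u) ap v (app i f) = applied-not-inert C ap v i
  applied-not-inert (appʳ u C) ap v (app i f) = applied-not-fireball C ap v f
  applied-not-inert (es C u)   ap v i         = applied-not-inert C ap v i

  applied-not-fireball : (C : Shallow A n m) {h : Term A withES m} {σ : Sub A plain n p} →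
    applied false C ≡ true → Value (⟦ h ⟧ (env σ C)) → ¬ Fireball (⟦ C ⟨ h ⟩ ⟧ σ)
  applied-not-fireball (appˡ C u) ap v (inert i) = applied-not-inert {b = false} (appˡ C u) ap v i
  applied-not-fireball (appʳ u C) ap v (inert i) = applied-not-inert {b = false} (appʳ u C) ap v i
  applied-not-fireball (es C u)   ap v f         = applied-not-fireball C ap v f

app-injective : {t t′ u u′ : Term A withES n} → app t u ≡ app t′ u′ → t ≡ t′ × u ≡ u′
app-injective refl = refl , refl

es-injective : {t t′ : Term A withES (suc n)} {u u′ : Term A withES n} → es t u ≡ es t′ u′ → t ≡ t′ × u ≡ u′
es-injective refl = refl , refl

-- An evaluable position to the left of an argument forces the
-- argument to unfold to a fireball, whereas a position inside it forces it not to.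
position-unique : ∀ {b} {σ : Sub A plain n p} (C : Shallow A n m) (C′ : Shallow A n q) {h h′} →
  C′ ⟨ h′ ⟩ ≡ C ⟨ h ⟩ → Eval σ C → Eval σ C′ → applied b C ≡ true → applied b C′ ≡ true →
  Atom (env σ C) h → Atom (env σ C′) h′ →
  _≡_ {A = Located A n} (_ , C , h) (_ , C′ , h′)
position-unique □ □ refl E E′ ap ap′ a a′ = refl
position-unique □ (appˡ _ _) () E E′ ap ap′ lam a′
position-unique □ (appˡ _ _) () E E′ ap ap′ (var _) a′
position-unique □ (appʳ _ _) () E E′ ap ap′ lam a′
position-unique □ (appʳ _ _) () E E′ ap ap′ (var _) a′
position-unique □ (es _ _)   () E E′ ap ap′ lam a′
position-unique □ (es _ _)   () E E′ ap ap′ (var _) a′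
position-unique (appˡ _ _) □ () E E′ ap ap′ a lam
position-unique (appˡ _ _) □ () E E′ ap ap′ a (var _)
position-unique (appʳ _ _) □ () E E′ ap ap′ a lam
position-unique (appʳ _ _) □ () E E′ ap ap′ a (var _)
position-unique (es _ _)   □ () E E′ ap ap′ a lam
position-unique (es _ _)   □ () E E′ ap ap′ a (var _)
position-unique (appˡ C u) (appˡ C′ u′) eq (E , _) (E′ , _) ap ap′ a a′ with app-injective eq
... | eq′ , refl = cong (λ (m , C , h) → m , appˡ C u , h) (position-unique C C′ eq′ E E′ ap ap′ a a′)
position-unique (appʳ u C) (appʳ u′ C′) eq E E′ ap ap′ a a′ with app-injective eq
... | refl , eq′ = cong (λ (m , C , h) → m , appʳ u C , h) (position-unique C C′ eq′ E E′ ap ap′ a a′)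
position-unique (es C u) (es C′ u′) eq (_ , E) (_ , E′) ap ap′ a a′ with es-injective eq
... | eq′ , refl = cong (λ (m , C , h) → m , es C u , h) (position-unique C C′ eq′ E E′ ap ap′ a a′)
position-unique (appˡ C u) (appʳ u′ C′) eq (_ , f) E′ ap ap′ a a′ with app-injective eq
... | _ , refl = ⊥-elim (applied-not-fireball C′ ap′ (atom-value a′) f)
position-unique (appʳ u C) (appˡ C′ u′) eq E (_ , f) ap ap′ a a′ with app-injective eq
... | _ , refl = ⊥-elim (applied-not-fireball C ap (atom-value a) f)

active-unique : ∀ {b} {σ : Sub A plain n p} {t} {C : Shallow A n m} {h} {C′ : Shallow A n q} {h′} →
                Active b σ t C h → Active b σ t C′ h′ →
                _≡_ {A = Located A n} (_ , C , h) (_ , C′ , h′)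
active-unique {C = C} {C′ = C′} (active refl E ap a) (active eq E′ ap′ a′) =
  position-unique C C′ eq E E′ ap ap′ a a′

-- The reduct is a function of the active position, because the decompositions
-- displayed in the two rules can be computed from it.

data Split {A : Set} : Shallow A n m → Set where
  subs  : (L : SubCtx A n m) → Split ⌊ L ⌋
  app   : (S : Shallow A n p) (L : SubCtx A p m) (u : Term A withES p) →
          Split (S ⟪ appˡ ⌊ L ⌋ u ⟫)
  other : {C : Shallow A n m} → (∀ b → applied b C ≡ false) → Split C

split : (C : Shallow A n m) → Split C
split □ = subs □
split (appˡ C u) with split C
... | subs L    = app □ L u
... | app S L v = app (appˡ S u) L v
... | other eq  = other (λ _ → eq true)
split (appʳ u C) with split C
... | subs L    = other (λ _ → applied-sub false L)
... | app S L v = app (appʳ u S) L v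
... | other eq  = other (λ _ → eq false)
split (es C u) with split C
... | subs L    = subs (es L u)
... | app S L v = app (es S u) L v
... | other eq  = other eq

split-sub : (L : SubCtx A n m) → split ⌊ L ⌋ ≡ subs L
split-sub □        = refl
split-sub (es L u) rewrite split-sub L = refl

split-app : (S : Shallow A n m) (L : SubCtx A m p) (u : Term A withES m) →
            split (S ⟪ appˡ ⌊ L ⌋ u ⟫) ≡ app S L u
split-app □          L u rewrite split-sub L     = refl
split-app (appˡ S v) L u rewrite split-app S L u = refl
split-app (appʳ v S) L u rewrite split-app S L u = refl
split-app (es S v)   L u rewrite split-app S L u = refl

data Binding {A : Set} : Shallow A n m → Fin m → Set where
  bound : (S : Shallow A n p) (S′ : Shallow A (suc p) m) (s : Term A withES p) →
          Binding (S ⟪ es S′ s ⟫) (weaken S′ zero)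
  free  : (C : Shallow A n m) (y : Fin n) → Binding C (weaken C y)

binding : (C : Shallow A n m) (x : Fin m) → Binding C x
binding □ x = free □ x
binding (appˡ C u) x with binding C x
... | bound S S′ s = bound (appˡ S u) S′ s
... | free _ y     = free (appˡ C u) y
binding (appʳ u C) x with binding C x
... | bound S S′ s = bound (appʳ u S) S′ s
... | free _ y     = free (appʳ u C) y
binding (es C u) x with binding C x
... | bound S S′ s   = bound (es S u) S′ s
... | free _ zero    = bound □ C u
... | free _ (suc y) = free (es C u) y

binding-free : (C : Shallow A n m) (y : Fin n) → binding C (weaken C y) ≡ free C y
binding-free □          y = refl
binding-free (appˡ C u) y rewrite binding-free C y       = refl
binding-free (appʳ u C) y rewrite binding-free C y       = refl
binding-free (es C u)   y rewrite binding-free C (suc y) = refl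

binding-bound : (S : Shallow A n p) (S′ : Shallow A (suc p) m) (s : Term A withES p) →
                binding (S ⟪ es S′ s ⟫) (weaken S′ zero) ≡ bound S S′ s
binding-bound □          S′ s rewrite binding-free S′ zero = refl
binding-bound (appˡ S u) S′ s rewrite binding-bound S S′ s = refl
binding-bound (appʳ u S) S′ s rewrite binding-bound S S′ s = refl
binding-bound (es S u)   S′ s rewrite binding-bound S S′ s = refl

data Peel {A : Set} : Term A withES n → Set where
  peeled : (L : SubCtx A n m) (u : Term A withES m) → NotES u → Peel (⌊ L ⌋ ⟨ u ⟩)

peel : (t : Term A withES n) → Peel t
peel (var x)   = peeled □ _ λ ()
peel (symb a)  = peeled □ _ λ ()
peel (lam t)   = peeled □ _ λ ()
peel (app t u) = peeled □ _ λ ()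
peel (es t u) with peel t
... | peeled L v ¬es = peeled (es L u) v ¬es

-- The proof of `NotES` that `peel` computes need not be the given one, so it is quantified
-- existentially.
peel-plug : (L : SubCtx A n m) (u : Term A withES m) → NotES u →
            Σ[ ¬es ∈ NotES u ] peel (⌊ L ⌋ ⟨ u ⟩) ≡ peeled L u ¬es
peel-plug □        (var x)   _   = _ , refl
peel-plug □        (symb a)  _   = _ , refl
peel-plug □        (lam t)   _   = _ , refl
peel-plug □        (app t u) _   = _ , refl
peel-plug □        (es t u)  ¬es = ⊥-elim (¬es (t , u , refl))
peel-plug (es L v) u ¬es with peel-plug L u ¬es
... | ¬es′ , eq rewrite eq = ¬es′ , refl

contract-lam : {C : Shallow A n m} → Split C → Term A withES (suc m) → Maybe (Term A withES n)
contract-lam (app S L u) t = just (S ⟨ um-reduct L t u ⟩)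
contract-lam (subs _)    t = nothing
contract-lam (other _)   t = nothing

contract-es : Shallow A n m → Shallow A (suc m) p → {s : Term A withES m} → Peel s → Term A withES n
contract-es S S′ (peeled L u _) = S ⟨ ue-reduct S′ L u ⟩

contract-var : {C : Shallow A n m} {x : Fin m} → Binding C x → Maybe (Term A withES n)
contract-var (bound S S′ s) = just (contract-es S S′ (peel s))
contract-var (free _ _)     = nothing

contract : Located A n → Maybe (Term A withES n)
contract (_ , C , lam t) = contract-lam (split C) t
contract (_ , C , var x) = contract-var (binding C x)
contract _               = nothing

-- Correspondence between steps and active positions.

plug-⟪⟫ : (S : Shallow A n m) (T : Shallow A m p) (t : Term A withES p) →
          (S ⟪ T ⟫) ⟨ t ⟩ ≡ S ⟨ T ⟨ t ⟩ ⟩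
plug-⟪⟫ □          T t = refl
plug-⟪⟫ (appˡ S u) T t = cong₂ app (plug-⟪⟫ S T t) refl
plug-⟪⟫ (appʳ u S) T t = cong (app u) (plug-⟪⟫ S T t)
plug-⟪⟫ (es S u)   T t = cong₂ es (plug-⟪⟫ S T t) refl

um-active : (S : Shallow A n m) (L : SubCtx A m p) (t : Term A withES (suc p)) (u : Term A withES m) →
            Useful (S ⟪ appˡ ⌊ L ⌋ u ⟫) →
            Active false var (S ⟨ um-redex L t u ⟩) (S ⟪ appˡ ⌊ L ⌋ u ⟫) (lam t)
um-active S L t u (E , ap) =
  active (plug-⟪⟫ S (appˡ ⌊ L ⌋ u) (lam t)) (Evaluable⇒Eval _ E) (Applicative⇒applied _ ap) lam

env-ue-redex : (S : Shallow A n m) (S′ : Shallow A (suc m) p) (L : SubCtx A m q) (u : Term A withES q) →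
  env var (S ⟪ es S′ (⌊ L ⌋ ⟨ u ⟩) ⟫) (weaken S′ zero) ≡ ⟦ u ⟧ (env (env var S) ⌊ L ⌋)
env-ue-redex S S′ L u =
  trans (cong (λ τ → τ (weaken S′ zero)) (env-⟪⟫ var S (es S′ (⌊ L ⌋ ⟨ u ⟩))))
    (trans (env-weaken _ S′ zero) (⟦⟧-plug-sub L u (env var S)))

↓[]-ue : (S : Shallow A n m) (L : SubCtx A m q) (u : Term A withES q) →
         u ↓[ S ⟪ ⌊ L ⌋ ⟫ ] ≡ ⟦ u ⟧ (env (env var S) ⌊ L ⌋)
↓[]-ue S L u = trans (↓[]-⟦⟧ (S ⟪ ⌊ L ⌋ ⟫) u) (cong ⟦ u ⟧ (env-⟪⟫ var S ⌊ L ⌋))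

ue-active : (S : Shallow A n m) (S′ : Shallow A (suc m) p) (L : SubCtx A m q) (u : Term A withES q) →
            Useful (S ⟪ es S′ (⌊ L ⌋ ⟨ u ⟩) ⟫) → Value (u ↓[ S ⟪ ⌊ L ⌋ ⟫ ]) →
            Active false var (S ⟨ ue-redex S′ L u ⟩)
                   (S ⟪ es S′ (⌊ L ⌋ ⟨ u ⟩) ⟫) (var (weaken S′ zero))
ue-active S S′ L u (E , ap) v =
  active (plug-⟪⟫ S (es S′ (⌊ L ⌋ ⟨ u ⟩)) _) (Evaluable⇒Eval _ E) (Applicative⇒applied _ ap)
    (var (subst Value (trans (↓[]-ue S L u) (sym (env-ue-redex S S′ L u))) v))

uf-active : {t u : Term A withES n} → (_⊸um_ ∪ _⊸ue_) t u →
            Σ[ (_ , C , h) ∈ Located A n ] Active false var t C h × contract (_ , C , h) ≡ just u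
uf-active (inj₁ (step S L t u us)) =
  _ , um-active S L t u us , cong (λ s → contract-lam s t) (split-app S L u)
uf-active (inj₂ (step S S′ L u us ¬es v)) =
  _ , ue-active S S′ L u us v ,
  trans (cong contract-var (binding-bound S S′ (⌊ L ⌋ ⟨ u ⟩)))
        (cong (just ∘ contract-es S S′) (proj₂ (peel-plug L u ¬es)))

-- Both steps have an active position; the two positions coincide, and each reduct is what
-- `contract` computes there.
uf-deterministic : Deterministic _≡_ (_⊸um_ {A} {n} ∪ _⊸ue_)
uf-deterministic r s with uf-active r | uf-active s
... | _ , P , eq | _ , Q , eq′ =
  just-injective (trans (sym eq) (trans (cong contract (active-unique P Q)) eq′))

applied⇒Applicative : (C : Shallow A n m) → applied false C ≡ true → Applicative C
applied⇒Applicative C ap with split C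
... | subs L    = case trans (sym ap) (applied-sub false L) of λ ()
... | app S L u = _ , S , L , u , refl
... | other eq  = case trans (sym ap) (eq false) of λ ()

active⇒uf : {t : Term A withES n} {C : Shallow A n m} {h : Term A withES m} →
            Active false var t C h → ∃[ u ] (_⊸um_ ∪ _⊸ue_) t u
active⇒uf {C = C} (active refl E ap (lam {t})) with applied⇒Applicative C ap
... | _ , S , L , u , refl = _ , inj₁ (subst (_⊸um S ⟨ um-reduct L t u ⟩)
  (sym (plug-⟪⟫ S (appˡ ⌊ L ⌋ u) (lam t)))
  (step S L t u (Eval⇒Evaluable _ E , _ , S , L , u , refl)))
active⇒uf {C = C} (active refl E ap (var {x} v)) with binding C x
-- The initial environment sends free variables to variables, so an entry that is a value belongs to
-- a variable bound by `C`.
... | free _ y = case subst Value (env-weaken var C y) v of λ ()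
... | bound S S′ s with peel s
... | peeled L u ¬es = _ , inj₂ (subst (_⊸ue S ⟨ ue-reduct S′ L u ⟩)
  (sym (plug-⟪⟫ S (es S′ (⌊ L ⌋ ⟨ u ⟩)) _))
  (step S S′ L u (Eval⇒Evaluable _ E , applied⇒Applicative _ ap) ¬es
    (subst Value (trans (env-ue-redex S S′ L u) (sym (↓[]-ue S L u))) v)))

-- The invariant of derivations from λ-terms

-- Plain bodies ensure that a multiplicative step uncovers no explicit substitution besides the one
-- it creates; fireball contents let evaluable contexts cross any substitution.
Proper : Sub A plain n p → Term A withES n → Set
Proper σ (var x)   = ⊤
Proper σ (symb a)  = ⊤
Proper σ (lam t)   = ∃[ s ] t ≡ ⌜ s ⌝
Proper σ (app t u) = Proper σ t × Proper σ u
Proper σ (es t u)  = Fireball (⟦ u ⟧ σ) × Proper σ u × Proper (⟦ u ⟧ σ • σ) t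

Proper-⌜⌝ : (t : Term A plain n) {σ : Sub A plain n p} → Proper σ ⌜ t ⌝
Proper-⌜⌝ (var x)   = tt
Proper-⌜⌝ (symb a)  = tt
Proper-⌜⌝ (lam t)   = t , refl
Proper-⌜⌝ (app t u) = Proper-⌜⌝ t , Proper-⌜⌝ u

rename-⌜⌝ : (ρ : Ren n m) (t : Term A plain n) → rename ρ ⌜ t ⌝ ≡ ⌜ rename ρ t ⌝
rename-⌜⌝ ρ (var x)   = refl
rename-⌜⌝ ρ (symb a)  = refl
rename-⌜⌝ ρ (lam t)   = cong lam (rename-⌜⌝ (liftᴿ ρ) t)
rename-⌜⌝ ρ (app t u) = cong₂ app (rename-⌜⌝ ρ t) (rename-⌜⌝ ρ u)

Proper-rename : (t : Term A withES n) {ρ : Ren n m} {σ : Sub A plain m p} {τ : Sub A plain n p} →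
                (∀ x → σ (ρ x) ≡ τ x) → Proper τ t → Proper σ (rename ρ t)
Proper-rename (var x)   eq _           = tt
Proper-rename (symb a)  eq _           = tt
Proper-rename (lam t)   eq (s , refl)  = _ , rename-⌜⌝ _ s
Proper-rename (app t u) eq (P , Q)     = Proper-rename t eq P , Proper-rename u eq Q
Proper-rename (es t u)  eq (f , Q , P) =
  subst Fireball (sym (⟦⟧-rename u eq)) f , Proper-rename u eq Q ,
  Proper-rename t (λ { zero → ⟦⟧-rename u eq ; (suc x) → eq x }) P

Proper-hole : (S : Shallow A n m) {t : Term A withES m} {σ : Sub A plain n p} →
              Proper σ (S ⟨ t ⟩) → Proper (env σ S) t
Proper-hole □          P           = P
Proper-hole (appˡ S u) (P , _)     = Proper-hole S P
Proper-hole (appʳ u S) (_ , P)     = Proper-hole S P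
Proper-hole (es S u)   (_ , _ , P) = Proper-hole S P

Proper-replace : (S : Shallow A n m) {t u : Term A withES m} {σ : Sub A plain n p} →
                 Proper σ (S ⟨ t ⟩) → Proper (env σ S) u → Proper σ (S ⟨ u ⟩)
Proper-replace □          P           R = R
Proper-replace (appˡ S v) (P , Q)     R = Proper-replace S P R , Q
Proper-replace (appʳ v S) (Q , P)     R = Q , Proper-replace S P R
Proper-replace (es S v)   (f , Q , P) R = f , Q , Proper-replace S P R

Proper-plug-rename : (S : Shallow A n m) {ρ : Ren n p} {σ : Sub A plain p q} {τ : Sub A plain n q}
  {t : Term A withES m} {u : Term A withES (holeScope S p)} → (∀ x → σ (ρ x) ≡ τ x) →
  Proper τ (S ⟨ t ⟩) → Proper (env σ (renameᶜ ρ S)) u → Proper σ (renameᶜ ρ S ⟨ u ⟩)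
Proper-plug-rename □          eq P           R = R
Proper-plug-rename (appˡ S v) eq (P , Q)     R = Proper-plug-rename S eq P R , Proper-rename v eq Q
Proper-plug-rename (appʳ v S) eq (Q , P)     R = Proper-rename v eq Q , Proper-plug-rename S eq P R
Proper-plug-rename (es S v)   eq (f , Q , P) R =
  subst Fireball (sym (⟦⟧-rename v eq)) f , Proper-rename v eq Q ,
  Proper-plug-rename S (λ { zero → ⟦⟧-rename v eq ; (suc x) → eq x }) P R

-- After an exponential step, `L` lies on the path to the next active position.
Proper-sub⇒Eval : (L : SubCtx A n m) {t : Term A withES m} {σ : Sub A plain n p} →
                  Proper σ (⌊ L ⌋ ⟨ t ⟩) → Eval σ ⌊ L ⌋
Proper-sub⇒Eval □        P           = tt
Proper-sub⇒Eval (es L u) (f , _ , P) = f , Proper-sub⇒Eval L P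

Proper-um : (L : SubCtx A n m) (t : Term A withES (suc m)) (u : Term A withES n)
            {τ : Sub A plain n p} → Fireball (⟦ u ⟧ τ) →
            Proper τ (um-redex L t u) → Proper τ (um-reduct L t u)
Proper-um L t u {τ} f (P , Q) with Proper-hole ⌊ L ⌋ P
... | s , refl = Proper-replace ⌊ L ⌋ P
  ( subst Fireball (sym (⟦⟧-rename u (env-weaken τ ⌊ L ⌋))) f
  , Proper-rename u (env-weaken τ ⌊ L ⌋) Q
  , Proper-⌜⌝ s )

Proper-ue : (S : Shallow A (suc n) m) (L : SubCtx A n p) (u : Term A withES p)
            {τ : Sub A plain n q} → Proper τ (ue-redex S L u) → Proper τ (ue-reduct S L u)
Proper-ue S L u {τ} (f , Q , P) = Proper-replace ⌊ L ⌋ Q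
  ( subst Fireball (⟦⟧-plug-sub L u τ) f
  , Proper-hole ⌊ L ⌋ Q
  , Proper-plug-rename S (env-ue L u τ) P
      (Proper-rename u (λ x → env-weaken _ S″ (suc x)) (Proper-hole ⌊ L ⌋ Q)) )
  where S″ = renameᶜ (liftᴿ (weaken ⌊ L ⌋)) S

Proper-uf : {t u : Term A withES n} → (_⊸um_ ∪ _⊸ue_) t u → Proper var t → Proper var u
Proper-uf (inj₁ (step S L t u (E , _))) P with Eval-⟪⟫⁻ S (Evaluable⇒Eval _ E)
-- Usefulness of `S⟨L u⟩` includes that the argument `u`, about to become a content, unfolds to a
-- fireball.
... | _ , _ , f = Proper-replace S P (Proper-um L t u f (Proper-hole S P))
Proper-uf (inj₂ (step S S′ L u _ _ _)) P =
  Proper-replace S P (Proper-ue S′ L u (Proper-hole S P))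

-- Normal forms

ActiveIn : Bool → Sub A plain n p → Term A withES n → Set
ActiveIn {A = A} {n = n} b σ t = Σ[ (_ , C , h) ∈ Located A n ] Active b σ t C h

active-appˡ : ∀ {b} {σ : Sub A plain n p} {t u} → Fireball (⟦ u ⟧ σ) →
              ActiveIn true σ t → ActiveIn b σ (app t u)
active-appˡ f ((_ , C , h) , active eq E ap a) =
  (_ , appˡ C _ , h) , active (cong₂ app eq refl) (E , f) ap a

active-appʳ : ∀ {b} {σ : Sub A plain n p} {t u} →
              ActiveIn false σ u → ActiveIn b σ (app t u)
active-appʳ ((_ , C , h) , active eq E ap a) =
  (_ , appʳ _ C , h) , active (cong (app _) eq) E ap a

active-es : ∀ {b} {σ : Sub A plain n p} {t u} → Fireball (⟦ u ⟧ σ) →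
            ActiveIn b (⟦ u ⟧ σ • σ) t → ActiveIn b σ (es t u)
active-es f ((_ , C , h) , active eq E ap a) =
  (_ , es C _ , h) , active (cong₂ es eq refl) (f , E) ap a

-- Below its outer substitutions, such a term is an abstraction or a variable whose entry is a
-- value; `true` records that it stands in head position.
value⇒active : (t : Term A withES n) {σ : Sub A plain n p} → Proper σ t →
               Value (⟦ t ⟧ σ) → ActiveIn true σ t
value⇒active (var x)  P           v = _ , active refl tt refl (var v)
value⇒active (lam t)  P           v = (_ , □ , lam t) , active refl tt refl lam
value⇒active (es t u) (f , _ , P) v = active-es f (value⇒active t P v)

-- Environment entries stay irreducible, being extended by fireballs only, so the redex comes from
-- an application of `t` itself and not from an unfolded variable.
⇒⇒active : ∀ {b} (t : Term A withES n) {σ : Sub A plain n p} {r} → (∀ x → Irreducible (σ x)) →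
           Proper σ t → ⟦ t ⟧ σ ⇒ r → ActiveIn b σ t
⇒⇒active (var x)   irr P           r = ⊥-elim (irr x r)
⇒⇒active (app t u) irr (P , Q)     r with ⇒-app⁻ r
... | inj₁ (v , f)              = active-appˡ f (value⇒active t P v)
... | inj₂ (inj₁ (_ , s))       = active-appʳ (⇒⇒active u irr Q s)
... | inj₂ (inj₂ ((_ , s) , f)) = active-appˡ f (⇒⇒active t irr P s)
⇒⇒active (es t u)  irr (f , _ , P) r =
  active-es f (⇒⇒active t (λ { zero → fireball-irreducible f ; (suc x) → irr x }) P r)

uf-normal⇒f-normal : (t : Term A withES n) → Proper var t →
                     IsNormalForm (_⊸um_ ∪ _⊸ue_) t → IsNormalForm _→f_ (t ↓)
uf-normal⇒f-normal t P nf (_ , r) = nf (active⇒uf (proj₂ (⇒⇒active t (λ _ ()) P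
  (subst (_⇒ _) (sym (↓-⟦⟧ t (λ _ → refl))) (→f⇒⇒ r)))))

-- Counting explicit substitutions

-- Abstractions count zero: under the invariant their bodies contain no explicit substitution.
count : Term A withES n → ℕ
count (var x)   = 0
count (symb a)  = 0
count (lam t)   = 0
count (app t u) = count t + count u
count (es t u)  = suc (count t + count u)

countᶜ : Shallow A n m → ℕ
countᶜ □          = 0
countᶜ (appˡ S u) = countᶜ S + count u
countᶜ (appʳ u S) = countᶜ S + count u
countᶜ (es S u)   = suc (countᶜ S + count u)

count-⌜⌝ : (t : Term A plain n) → count ⌜ t ⌝ ≡ 0
count-⌜⌝ (var x)   = refl
count-⌜⌝ (symb a)  = refl
count-⌜⌝ (lam t)   = refl
count-⌜⌝ (app t u) = cong₂ _+_ (count-⌜⌝ t) (count-⌜⌝ u)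

count-rename : (ρ : Ren n m) (t : Term A withES n) → count (rename ρ t) ≡ count t
count-rename ρ (var x)   = refl
count-rename ρ (symb a)  = refl
count-rename ρ (lam t)   = refl
count-rename ρ (app t u) = cong₂ _+_ (count-rename ρ t) (count-rename ρ u)
count-rename ρ (es t u)  = cong suc (cong₂ _+_ (count-rename (liftᴿ ρ) t) (count-rename ρ u))

countᶜ-rename : (S : Shallow A n m) (ρ : Ren n p) → countᶜ (renameᶜ ρ S) ≡ countᶜ S
countᶜ-rename □          ρ = refl
countᶜ-rename (appˡ S u) ρ = cong₂ _+_ (countᶜ-rename S ρ) (count-rename ρ u)
countᶜ-rename (appʳ u S) ρ = cong₂ _+_ (countᶜ-rename S ρ) (count-rename ρ u)
countᶜ-rename (es S u)   ρ = cong suc (cong₂ _+_ (countᶜ-rename S (liftᴿ ρ)) (count-rename ρ u))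

swap-last : ∀ a b c → a + b + c ≡ a + c + b
swap-last = solve-∀

count-plug : (S : Shallow A n m) (t : Term A withES m) → count (S ⟨ t ⟩) ≡ countᶜ S + count t
count-plug □          t = refl
count-plug (appˡ S u) t =
  trans (cong (_+ count u) (count-plug S t)) (swap-last (countᶜ S) (count t) (count u))
count-plug (appʳ u S) t =
  trans (+-comm (count u) _)
    (trans (cong (_+ count u) (count-plug S t)) (swap-last (countᶜ S) (count t) (count u)))
count-plug (es S u)   t = cong suc
  (trans (cong (_+ count u) (count-plug S t)) (swap-last (countᶜ S) (count t) (count u)))

count-um : (L : SubCtx A n m) (s : Term A plain (suc m)) (u : Term A withES n) →
           count (um-reduct L ⌜ s ⌝ u) ≡ suc (count (um-redex L ⌜ s ⌝ u))
count-um L s u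
  rewrite count-plug ⌊ L ⌋ (es ⌜ s ⌝ (rename (weaken ⌊ L ⌋) u)) | count-plug ⌊ L ⌋ (lam ⌜ s ⌝)
        | count-⌜⌝ s | count-rename (weaken ⌊ L ⌋) u = lemma (countᶜ ⌊ L ⌋) (count u)
  where
  lemma : ∀ a b → a + suc b ≡ suc (a + 0 + b)
  lemma = solve-∀

atom-count : {τ : Sub A plain m p} {h : Term A withES m} → Atom τ h → count h ≡ 0
atom-count lam     = refl
atom-count (var _) = refl

count-plug-rename : (S : Shallow A n m) (ρ : Ren n p) (θ : Ren q (holeScope S p)) (u : Term A withES q) →
                    count (renameᶜ ρ S ⟨ rename θ u ⟩) ≡ countᶜ S + count u
count-plug-rename S ρ θ u =
  trans (count-plug (renameᶜ ρ S) (rename θ u)) (cong₂ _+_ (countᶜ-rename S ρ) (count-rename θ u))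

-- The step duplicates `u`, hence the hypothesis; it is met because the copied term is an
-- abstraction or a variable.
count-ue : (S : Shallow A (suc n) m) (L : SubCtx A n p) (u : Term A withES p) → count u ≡ 0 →
           count (ue-reduct S L u) ≡ count (ue-redex S L u)
count-ue S L u u≡0 = begin
  count (ue-reduct S L u)
    ≡⟨ count-plug ⌊ L ⌋ (es (S″ ⟨ rename (weaken S″ ∘ suc) u ⟩) u) ⟩
  l + suc (count (S″ ⟨ rename (weaken S″ ∘ suc) u ⟩) + count u)
    ≡⟨ cong (λ c → l + suc (c + count u)) (count-plug-rename S _ (weaken S″ ∘ suc) u) ⟩
  l + suc (countᶜ S + count u + count u)
    ≡⟨ cong (λ c → l + suc (countᶜ S + c + count u)) u≡0 ⟩
  l + suc (countᶜ S + 0 + count u)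
    ≡⟨ lemma l (countᶜ S) (count u) ⟩
  suc (countᶜ S + 0 + (l + count u))
    ≡⟨ cong suc (cong₂ _+_ (count-plug S (var (weaken S zero))) (count-plug ⌊ L ⌋ u)) ⟨
  count (ue-redex S L u) ∎
  where
  open ≡-Reasoning
  S″ = renameᶜ (liftᴿ (weaken ⌊ L ⌋)) S
  l  = countᶜ ⌊ L ⌋
  lemma : ∀ a b c → a + suc (b + 0 + c) ≡ suc (b + 0 + (a + c))
  lemma = solve-∀

ue-atom : (S : Shallow A n m) (L : SubCtx A m q) (u : Term A withES q) → NotES u →
          Value (u ↓[ S ⟪ ⌊ L ⌋ ⟫ ]) → Atom (env (env var S) ⌊ L ⌋) u
ue-atom S L u ¬es v = value-atom u ¬es (subst Value (↓[]-ue S L u) v)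

uf-invariant : {t u : Term A withES n} (d : Star (_⊸um_ ∪ _⊸ue_) t u) → Proper var t →
               Proper var u × count u ≡ count t + ∣ d ∣ₘ
uf-invariant ε P = P , sym (+-identityʳ _)
uf-invariant (r@(inj₁ (step S L t u _)) ◅ d) P
  with uf-invariant d (Proper-uf r P) | Proper-hole ⌊ L ⌋ (proj₁ (Proper-hole S P))
... | Q , eq | s , refl = Q , trans eq (trans (cong (_+ ∣ d ∣ₘ) step-count) (sym (+-suc _ ∣ d ∣ₘ)))
  where
  step-count : count (S ⟨ um-reduct L ⌜ s ⌝ u ⟩) ≡ suc (count (S ⟨ um-redex L ⌜ s ⌝ u ⟩))
  step-count rewrite count-plug S (um-reduct L ⌜ s ⌝ u) | count-plug S (um-redex L ⌜ s ⌝ u)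
                   | count-um L s u = +-suc (countᶜ S) _
uf-invariant (r@(inj₂ (step S S′ L u _ ¬es v)) ◅ d) P with uf-invariant d (Proper-uf r P)
... | Q , eq = Q , trans eq (cong (_+ ∣ d ∣ₘ) step-count)
  where
  step-count : count (S ⟨ ue-reduct S′ L u ⟩) ≡ count (S ⟨ ue-redex S′ L u ⟩)
  step-count rewrite count-plug S (ue-reduct S′ L u) | count-plug S (ue-redex S′ L u)
                   | count-ue S′ L u (atom-count (ue-atom S L u ¬es v)) = refl

-- Sequences of exponential steps

-- Adds to the accumulator `a` the explicit substitutions crossed on the path and those in their
-- contents; arguments beside the path are left out.
outer : ℕ → Shallow A n m → ℕ
outer a □          = a
outer a (appˡ S u) = outer a S
outer a (appʳ u S) = outer a S
outer a (es S u)   = outer (a + suc (count u)) S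

-- The weight of a variable bound by C counts the explicit substitutions that
-- bind it or are outside its binder on the path, with those in their contents.
weight : ℕ → (Fin n → ℕ) → Shallow A n m → Fin m → ℕ
weight a ω □          = ω
weight a ω (appˡ S u) = weight a ω S
weight a ω (appʳ u S) = weight a ω S
weight a ω (es S u)   = weight (a + suc (count u)) ((a + suc (count u)) ∷ ω) S

outer-⟪⟫ : ∀ a (S : Shallow A n m) (T : Shallow A m p) → outer a (S ⟪ T ⟫) ≡ outer (outer a S) T
outer-⟪⟫ a □          T = refl
outer-⟪⟫ a (appˡ S u) T = outer-⟪⟫ a S T
outer-⟪⟫ a (appʳ u S) T = outer-⟪⟫ a S T
outer-⟪⟫ a (es S u)   T = outer-⟪⟫ _ S T

weight-⟪⟫ : ∀ a ω (S : Shallow A n m) (T : Shallow A m p) →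
            weight a ω (S ⟪ T ⟫) ≡ weight (outer a S) (weight a ω S) T
weight-⟪⟫ a ω □          T = refl
weight-⟪⟫ a ω (appˡ S u) T = weight-⟪⟫ a ω S T
weight-⟪⟫ a ω (appʳ u S) T = weight-⟪⟫ a ω S T
weight-⟪⟫ a ω (es S u)   T = weight-⟪⟫ _ _ S T

weight-weaken : ∀ a ω (S : Shallow A n m) x → weight a ω S (weaken S x) ≡ ω x
weight-weaken a ω □          x = refl
weight-weaken a ω (appˡ S u) x = weight-weaken a ω S x
weight-weaken a ω (appʳ u S) x = weight-weaken a ω S x
weight-weaken a ω (es S u)   x = weight-weaken _ _ S (suc x)

weight≤outer : ∀ {a ω} (S : Shallow A n m) → (∀ x → ω x ≤ a) → ∀ x → weight a ω S x ≤ outer a S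
weight≤outer □          ω≤a = ω≤a
weight≤outer (appˡ S u) ω≤a = weight≤outer S ω≤a
weight≤outer (appʳ u S) ω≤a = weight≤outer S ω≤a
weight≤outer (es S u)   ω≤a =
  weight≤outer S (λ { zero → ≤-refl ; (suc x) → m≤n⇒m≤n+o _ (ω≤a x) })

outer≤count : ∀ a (S : Shallow A n m) → outer a S ≤ a + countᶜ S
outer≤count a □          = m≤m+n a 0
outer≤count a (appˡ S u) = ≤-trans (outer≤count a S) (+-monoʳ-≤ a (m≤m+n _ _))
outer≤count a (appʳ u S) = ≤-trans (outer≤count a S) (+-monoʳ-≤ a (m≤m+n _ _))
outer≤count a (es S u)   =
  ≤-trans (outer≤count _ S) (≤-reflexive (lemma a (count u) (countᶜ S)))
  where
  lemma : ∀ a b c → a + suc b + c ≡ a + suc (c + b)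
  lemma = solve-∀

-- An active abstraction weighs zero because its redex is multiplicative, which ends any exponential
-- sequence.
weight-located : Located A n → ℕ
weight-located (_ , C , var x) = weight 0 (λ _ → 0) C x
weight-located _               = 0

weight-located≤count : (C : Shallow A n m) (h : Term A withES m) →
                       weight-located (_ , C , h) ≤ count (C ⟨ h ⟩)
weight-located≤count C (var x)   = begin
  weight 0 (λ _ → 0) C x   ≤⟨ weight≤outer C (λ _ → z≤n) x ⟩
  outer 0 C                ≤⟨ outer≤count 0 C ⟩
  countᶜ C                 ≤⟨ m≤m+n _ 0 ⟩
  countᶜ C + 0             ≡⟨ count-plug C (var x) ⟨
  count (C ⟨ var x ⟩)      ∎
  where open ≤-Reasoning
weight-located≤count C (symb a)  = z≤n
weight-located≤count C (lam h)   = z≤n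
weight-located≤count C (app h k) = z≤n
weight-located≤count C (es h k)  = z≤n

module _ (S : Shallow A n m) (S′ : Shallow A (suc m) p) (L : SubCtx A m q) (u : Term A withES q) where

  private
    S″ = renameᶜ (liftᴿ (weaken ⌊ L ⌋)) S′
    C  = S ⟪ es S′ (⌊ L ⌋ ⟨ u ⟩) ⟫
    -- The next position passes through `L`, now outermost, and then into the moved copy of `S′`.
    C′ = S ⟪ ⌊ L ⌋ ⟪ es S″ u ⟫ ⟫
    h′ = rename (weaken S″ ∘ suc) u
    τ  = env var S
    τ′ = env τ ⌊ L ⌋

    env-C′ : env var C′ ≡ env (⟦ u ⟧ τ′ • τ′) S″
    env-C′ = trans (env-⟪⟫ var S _) (env-⟪⟫ τ ⌊ L ⌋ (es S″ u))

    applied-C′ : applied false C′ ≡ applied false C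
    applied-C′ = begin
      applied false C′                                ≡⟨ applied-⟪⟫ false S _ ⟩
      applied b (⌊ L ⌋ ⟪ es S″ u ⟫)                    ≡⟨ applied-⟪⟫ b ⌊ L ⌋ _ ⟩
      applied (applied b ⌊ L ⌋) S″                    ≡⟨ cong (λ b → applied b S″) (applied-sub b L) ⟩
      applied b S″                                    ≡⟨ applied-rename b S′ ⟩
      applied b S′                                    ≡⟨ applied-⟪⟫ false S _ ⟨
      applied false C                                 ∎
      where
      open ≡-Reasoning
      b = applied false S

    atom-C′ : Atom τ′ u → Atom (env (⟦ u ⟧ τ′ • τ′) S″) h′
    atom-C′ lam               = lam
    atom-C′ (var {x} v)       = var (subst Value (sym (env-weaken _ S″ (suc x))) v)

    weight-C : weight 0 (λ _ → 0) C (weaken S′ zero) ≡ outer 0 S + suc (count (⌊ L ⌋ ⟨ u ⟩))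
    weight-C = trans (cong (λ ω → ω (weaken S′ zero)) (weight-⟪⟫ 0 _ S _)) (weight-weaken _ _ S′ zero)

    weight-C′ : ∀ y → weight 0 (λ _ → 0) C′ (weaken S″ (suc y)) ≡ weight 0 (λ _ → 0) (S ⟪ ⌊ L ⌋ ⟫) y
    weight-C′ y = begin
      weight 0 _ C′ (weaken S″ (suc y))
        ≡⟨ cong (λ ω → ω (weaken S″ (suc y)))
             (trans (weight-⟪⟫ 0 _ S _) (weight-⟪⟫ _ _ ⌊ L ⌋ (es S″ u))) ⟩
      weight _ (_ ∷ weight (outer 0 S) (weight 0 _ S) ⌊ L ⌋) S″ (weaken S″ (suc y))
        ≡⟨ weight-weaken _ _ S″ (suc y) ⟩
      weight (outer 0 S) (weight 0 _ S) ⌊ L ⌋ y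
        ≡⟨ cong (λ ω → ω y) (weight-⟪⟫ 0 _ S ⌊ L ⌋) ⟨
      weight 0 _ (S ⟪ ⌊ L ⌋ ⟫) y ∎
      where open ≡-Reasoning

  -- The copy of u put in place of x is the next active position ...
  ue-next : Proper var (S ⟨ ue-redex S′ L u ⟩) → Eval var C → applied false C ≡ true → Atom τ′ u →
            Active false var (S ⟨ ue-reduct S′ L u ⟩) C′ h′
  ue-next P E ap a with Eval-⟪⟫⁻ S E | Proper-hole S P
  ... | E₁ , f , E₂ | _ , Q , _ = active
    (trans (plug-⟪⟫ S _ h′) (cong (S ⟨_⟩) (plug-⟪⟫ ⌊ L ⌋ (es S″ u) h′)))
    (Eval-⟪⟫⁺ S E₁ (Eval-⟪⟫⁺ ⌊ L ⌋ (Proper-sub⇒Eval L Q)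
      (subst Fireball (⟦⟧-plug-sub L u τ) f , Eval-rename S′ (env-ue L u τ) E₂)))
    (trans applied-C′ ap)
    (subst (λ σ → Atom σ h′) (sym env-C′) (atom-C′ a))

  -- ... and, when it is a variable, its binder is in S or in L.
  ue-weight : Atom τ′ u → weight-located (_ , C′ , h′) < weight-located (_ , C , var (weaken S′ zero))
  ue-weight lam = ≤-trans (s≤s z≤n) (≤-trans (m≤n+m _ (outer 0 S)) (≤-reflexive (sym weight-C)))
  ue-weight (var {y} _) = begin-strict
    weight 0 _ C′ (weaken S″ (suc y))             ≡⟨ weight-C′ y ⟩
    weight 0 _ (S ⟪ ⌊ L ⌋ ⟫) y                    ≤⟨ weight≤outer (S ⟪ ⌊ L ⌋ ⟫) (λ _ → z≤n) y ⟩
    outer 0 (S ⟪ ⌊ L ⌋ ⟫)                         ≡⟨ outer-⟪⟫ 0 S ⌊ L ⌋ ⟩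
    outer (outer 0 S) ⌊ L ⌋                       ≤⟨ outer≤count _ ⌊ L ⌋ ⟩
    outer 0 S + countᶜ ⌊ L ⌋                      ≤⟨ +-monoʳ-≤ (outer 0 S) (m≤m+n _ 0) ⟩
    outer 0 S + (countᶜ ⌊ L ⌋ + 0)                ≡⟨ cong (outer 0 S +_) (count-plug ⌊ L ⌋ (var y)) ⟨
    -- Strictness comes from the substitution binding the replaced variable, which counts itself.
    outer 0 S + count (⌊ L ⌋ ⟨ var y ⟩)           <⟨ +-monoʳ-< (outer 0 S) (n<1+n _) ⟩
    outer 0 S + suc (count (⌊ L ⌋ ⟨ var y ⟩))     ≡⟨ weight-C ⟨
    weight 0 _ C (weaken S′ zero)                 ∎
    where open ≤-Reasoning

-- By uniqueness, each step acts at the current active position, and the next one weighs strictly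
-- less.
ue-run≤weight : {t w : Term A withES n} {C : Shallow A n m} {h : Term A withES m} → Proper var t →
                Active false var t C h → (e : Star _⊸ue_ t w) → ∣ e ∣ ≤ weight-located (_ , C , h)
ue-run≤weight P X ε = z≤n
ue-run≤weight P X (r@(step S S′ L u us ¬es v) ◅ e) =
  ≤-trans (s≤s (ue-run≤weight (Proper-uf (inj₂ r) P) next e))
    (≤-trans (ue-weight S S′ L u a) (≤-reflexive (cong weight-located (sym (active-unique X Y)))))
  where
  a    = ue-atom S L u ¬es v
  Y    = ue-active S S′ L u us v
  next = ue-next S S′ L u P (evaluable Y) (is-applied Y) a

ue-run≤count : {t w : Term A withES n} → Proper var t → (e : Star _⊸ue_ t w) → ∣ e ∣ ≤ count t
ue-run≤count P ε = z≤n
ue-run≤count P e@(r ◅ _) with uf-active (inj₂ r)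
... | (_ , C , h) , X@(active refl _ _ _) , _ = ≤-trans (ue-run≤weight P X e) (weight-located≤count C h)

-- Overhead

module _ {X : Set} {M E : Rel X 0ℓ} where

  ∣◅◅∣ₘ : {x y z : X} (d : Star (M ∪ E) x y) (d′ : Star (M ∪ E) y z) → ∣ d ◅◅ d′ ∣ₘ ≡ ∣ d ∣ₘ + ∣ d′ ∣ₘ
  ∣◅◅∣ₘ ε            d′ = refl
  ∣◅◅∣ₘ (inj₁ _ ◅ d) d′ = cong suc (∣◅◅∣ₘ d d′)
  ∣◅◅∣ₘ (inj₂ _ ◅ d) d′ = ∣◅◅∣ₘ d d′

  ∣exponential∣ₘ : {x y z : X} (e : Star E x y) (r : M y z) →
                   ∣ map {U = M ∪ E} inj₂ e ◅◅ (inj₁ r ◅ ε) ∣ₘ ≡ 1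
  ∣exponential∣ₘ ε       r = refl
  ∣exponential∣ₘ (_ ◅ e) r = ∣exponential∣ₘ e r

  ∣◅◅∣-suc : {x y z : X} (e : Star E x y) (r : E y z) → ∣ e ◅◅ (r ◅ ε) ∣ ≡ suc ∣ e ∣
  ∣◅◅∣-suc ε       r = refl
  ∣◅◅∣-suc (_ ◅ e) r = cong suc (∣◅◅∣-suc e r)

  -- In the recursion, d₀ is empty or ends with a multiplicative step, and e is the
  -- part already seen of the exponential sequence that follows it.
  overhead : ∀ c {x : X} →
    (∀ {y z} (d : Star (M ∪ E) x y) (e : Star E y z) → ∣ e ∣ ≤ c * ∣ d ∣ₘ) →
    ∀ {y z w} (d₀ : Star (M ∪ E) x y) (e : Star E y z) (d : Star (M ∪ E) z w) →
    ∣ e ∣ + ∣ d ∣ ≤ ∣ d ∣ₘ + suc ∣ d ∣ₘ * (c * (∣ d₀ ∣ₘ + ∣ d ∣ₘ))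
  overhead c local d₀ e ε = begin
    ∣ e ∣ + 0                ≡⟨ +-identityʳ _ ⟩
    ∣ e ∣                    ≤⟨ local d₀ e ⟩
    c * ∣ d₀ ∣ₘ              ≡⟨ cong (c *_) (+-identityʳ _) ⟨
    c * (∣ d₀ ∣ₘ + 0)        ≡⟨ +-identityʳ _ ⟨
    c * (∣ d₀ ∣ₘ + 0) + 0    ∎
    where open ≤-Reasoning
  overhead c local d₀ e (inj₂ r ◅ d) = ≤-trans
    (≤-reflexive (trans (+-suc ∣ e ∣ ∣ d ∣) (cong (_+ ∣ d ∣) (sym (∣◅◅∣-suc e r)))))
    (overhead c local d₀ (e ◅◅ (r ◅ ε)) d)
  -- A multiplicative step closes the block `e`, bounded locally from `d₀`; it joins the `suc μ`
  -- blocks charged to the rest, each at `c * ν`.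
  overhead c local d₀ e (inj₁ r ◅ d) = begin
    ∣ e ∣ + suc ∣ d ∣                            ≤⟨ +-mono-≤ (local d₀ e) (s≤s (overhead c local d₁ ε d)) ⟩
    c * μ₀ + suc (μ + suc μ * (c * (∣ d₁ ∣ₘ + μ)))  ≡⟨ cong (λ j → c * μ₀ + suc (μ + suc μ * (c * j))) eq ⟩
    c * μ₀ + suc (μ + suc μ * (c * ν))            ≤⟨ +-monoˡ-≤ _ (*-monoʳ-≤ c (m≤m+n μ₀ (suc μ))) ⟩
    c * ν + suc (μ + suc μ * (c * ν))            ≡⟨ lemma (c * ν) μ ⟩
    suc μ + suc (suc μ) * (c * ν)                ∎
    where
    open ≤-Reasoning
    d₁ = d₀ ◅◅ (map inj₂ e ◅◅ (inj₁ r ◅ ε))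
    μ  = ∣ d ∣ₘ
    μ₀  = ∣ d₀ ∣ₘ
    ν  = μ₀ + suc μ
    eq : ∣ d₁ ∣ₘ + μ ≡ ν
    eq = trans (cong (_+ μ) (trans (∣◅◅∣ₘ d₀ _) (cong (μ₀ +_) (∣exponential∣ₘ e r)))) (+-assoc μ₀ 1 μ)
    lemma : ∀ a b → a + suc (b + suc b * a) ≡ suc b + suc (suc b) * a
    lemma = solve-∀

-- Both sides vanish at zero. Otherwise `μ ≤ μ * μ` and `suc μ ≤ μ + μ`, which gives the constant
-- `1 + 2 * c`.
quadratic-bound : ∀ c μ → μ + suc μ * (c * μ) ≤ (1 + 2 * c) * μ ^ 2
quadratic-bound c zero      = ≤-reflexive (lemma c)
  where
  lemma : ∀ c → c * 0 + 0 ≡ (c + (c + 0)) * 0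
  lemma = solve-∀
quadratic-bound c μ@(suc j) = begin
  μ + suc μ * (c * μ)            ≤⟨ +-mono-≤ (m≤m*n μ μ) (*-monoˡ-≤ (c * μ) (+-monoˡ-≤ μ (s≤s (z≤n {j})))) ⟩
  μ * μ + (μ + μ) * (c * μ)      ≡⟨ lemma c μ ⟩
  (1 + 2 * c) * μ ^ 2            ∎
  where
  open ≤-Reasoning
  lemma : ∀ c m → m * m + (m + m) * (c * m) ≡ (1 + 2 * c) * (m * (m * 1))
  lemma = solve-∀

locallyBounded⇒quadratic :
  {_⟶_ : ∀ {n} → Rel (Term A plain n) 0ℓ} {_⊸m_ _⊸e_ : ∀ {n} → Rel (Term A withES n) 0ℓ}
  (I : IsLocallyBoundedHighLevelImplementationSystem _⟶_ _⊸m_ _⊸e_) →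
  QuadraticOverhead _⟶_ _⊸m_ _⊸e_ (isHighLevelImplementationSystem I)
locallyBounded⇒quadratic I with IsLocallyBoundedHighLevelImplementationSystem.locallyBounded I
... | c , local = 1 + 2 * c , λ t d →
  subst (λ j → ∣ d ∣ ≤ (1 + 2 * c) * j ^ 2)
    (sym (proj₂ (IsLocallyBoundedHighLevelImplementationSystem.projection I t d)))
    (≤-trans (overhead c (λ d → local t d) ε ε d) (quadratic-bound c ∣ d ∣ₘ))

theorem8 : (A : Set) →
    Σ[ I ∈ IsLocallyBoundedHighLevelImplementationSystem {A} _→f_ _⊸um_ _⊸ue_ ]
    QuadraticOverhead {A} _→f_ _⊸um_ _⊸ue_ (isHighLevelImplementationSystem I)
theorem8 A = I , locallyBounded⇒quadratic I
  where
  I : IsLocallyBoundedHighLevelImplementationSystem {A} _→f_ _⊸um_ _⊸ue_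
  I = record
    { isHighLevelImplementationSystem = record
      { ⟶-deterministic = →f-deterministic
      ; ⊸-deterministic = uf-deterministic
      ; normalForm      = λ t {u} d →
          uf-normal⇒f-normal u (proj₁ (uf-invariant d (Proper-⌜⌝ t)))
      ; projection      = λ t d → uf-projects d
      }
    -- The constant is 1: `⌜ t ⌝` has no explicit substitutions, so `u` has exactly as many as there
    -- were multiplicative steps.
    ; locallyBounded = 1 , λ t {u} d e →
        let P , eq = uf-invariant d (Proper-⌜⌝ t) in
        ≤-trans (ue-run≤count P e) (≤-reflexive
          (trans eq (trans (cong (_+ ∣ d ∣ₘ) (count-⌜⌝ t)) (sym (*-identityˡ ∣ d ∣ₘ)))))
    }
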